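{- Let $n,k,h$ be integers with $2\leqslant k\leqslant n-1$ and $0\leqslant h\leqslant n-k$. Then the $h$-super edge-connectivity of the $(n,k)$-star graph $S_{n,k}$ is $$\lambda_s^{(h)}(S_{n,k})=\begin{cases}(n-h-1)(h+1) & \text{if } h\leqslant k-2 \text{ and } h\leqslant \frac{n}{2}-1,\\ (n-k+1)(k-1) & \text{otherwise.}\end{cases}$$
   Context: For integers $n,k$ with $1\leqslant k\leqslant n-1$, let $I_n=\{1,2,\ldots,n\}$ and let $P(n,k)=\{p_1p_2\cdots p_k : p_i\in I_n,\ p_i\neq p_j \text{ for } 1\leqslant i\neq j\leqslant k\}$ be the set of $k$-permutations on $I_n$. The $(n,k)$-star graph $S_{n,k}$ is the simple undirected graph with vertex set $P(n,k)$ in which a vertex $p=p_1p_2\cdots p_k$ is adjacent exactly to: (a) the vertices $p_ip_2\cdots p_{i-1}p_1p_{i+1}\cdots p_k$ for $2\leqslant i\leqslant k$ (swap $p_1$ with $p_i$); and (b) the vertices $\alpha p_2p_3\cdots p_k$ for $\alpha\in I_n\setminus\{p_i : 1\leqslant i\leqslant k\}$ (replace $p_1$ by $\alpha$). For a connected graph $G$ and an integer $h\geqslant 0$, an $h$-edge-cut of $G$ is a set $B$ of edges of $G$ such that $G-B$ (delete the edges in $B$, keep all vertices) is disconnected and has minimum degree at least $h$. The $h$-super edge-connectivity $\lambda_s^{(h)}(G)$ is the minimum cardinality over all $h$-edge-cuts of $G$ (when at least one exists). An asserted value of $\lambda_s^{(h)}(G)$ includes the assertion that an $h$-edge-cut exists.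 -}

module Defs where

open import Data.Fin.Base using (Fin)
import Data.Fin.Properties as Fin
open import Data.List.Base using (List; []; _∷_; length; filter; allFin; cartesianProductWith)
open import Data.List.Membership.Propositional using (_∈_)
open import Data.List.Membership.Propositional.Properties
  using (∈-allFin; ∈-cartesianProductWith⁺)
open import Data.List.Relation.Unary.All as All using (All; []; _∷_)
open import Data.List.Relation.Unary.AllPairs using (AllPairs; []; _∷_)
open import Data.List.Relation.Unary.Any as Any using (Any; here; there)
open import Data.List.Relation.Unary.Unique.Propositional using (Unique)
open import Data.List.Relation.Unary.Unique.Propositional.Properties
  using (allFin⁺; cartesianProductWith⁺)
open import Data.Irrelevant using ([_])
open import Data.Nat.Base using (ℕ; zero; suc; _≤_)
open import Data.Product.Base using (Σ-syntax; _×_; _,_; proj₁; proj₂; uncurry)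
open import Data.Refinement using (Refinement-syntax; _,_; value; value-injective)
open import Data.Sum.Base as Sum using (_⊎_; inj₁; inj₂)
open import Data.Vec.Base as Vec using (Vec; []; _∷_; lookup; _[_]≔_)
import Data.Vec.Membership.DecPropositional as DecMembership
open import Data.Vec.Membership.Propositional using () renaming (_∉_ to _∉ᵛ_)
open import Data.Vec.Membership.Propositional.Properties using (∈-lookup)
import Data.Vec.Properties as Vec
import Data.Vec.Relation.Unary.All as VecAll
import Data.Vec.Relation.Unary.AllPairs as VecAllPairs
import Data.Vec.Relation.Unary.Any as VecAny
import Data.Vec.Relation.Unary.Unique.Propositional as Vec using (Unique)
open import Function.Base using (_∘_)
open import Level using (0ℓ)
open import Relation.Binary.Construct.Closure.ReflexiveTransitive using (Star)
open import Relation.Binary.Core using (Rel)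
open import Relation.Binary.Definitions
  using (DecidableEquality; Decidable; Symmetric; Irreflexive)
open import Relation.Binary.PropositionalEquality
  using (_≡_; refl; sym; cong; cong₂; module ≡-Reasoning)
open import Relation.Nullary using (¬_; yes; no)
open import Relation.Nullary.Decidable as Dec using (¬?; recompute; _×-dec_; _⊎-dec_)
open import Relation.Nullary.Negation using (contradiction)
import Relation.Unary as U

record Graph : Set₁ where
  infix 4 _~_
  field
    Vertex   : Set
    _≟_      : DecidableEquality Vertex
    vertices : List Vertex
    unique   : Unique vertices
    complete : ∀ v → v ∈ vertices
    _~_      : Rel Vertex 0ℓ
    _~?_     : Decidable _~_
    ~-sym    : Symmetric _~_
    ~-irrefl : Irreflexive _≡_ _~_

module _ (G : Graph) where
  open Graph G

  degree : Vertex → ℕ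
  degree v = length (filter (v ~?_) vertices)

  MinDegreeAtLeast : ℕ → Set
  MinDegreeAtLeast h = ∀ v → h ≤ degree v

  Connected : Set
  Connected = ∀ u v → Star _~_ u v

  Disconnected : Set
  Disconnected = ¬ Connected

-- The edge {u , v} is represented by either of the pairs (u , v), (v , u).
infix 4 _≈ₑ_
_≈ₑ_ : ∀ {V : Set} → Rel (V × V) 0ℓ
(u , v) ≈ₑ (x , y) = (u ≡ x × v ≡ y) ⊎ (u ≡ y × v ≡ x)

record EdgeSet (G : Graph) : Set where
  open Graph G
  field
    edges    : List (Vertex × Vertex)
    areEdges : All (uncurry _~_) edges
    distinct : AllPairs (λ e f → ¬ e ≈ₑ f) edges

  size : ℕ
  size = length edges

infixl 6 _-_
_-_ : (G : Graph) → EdgeSet G → Graph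
G - B = record
  { Vertex   = Vertex
  ; _≟_      = _≟_
  ; vertices = vertices
  ; unique   = unique
  ; complete = complete
  ; _~_      = λ u v → u ~ v × ¬ (u , v) ∈ₑB
  ; _~?_     = λ u v → (u ~? v) ×-dec ¬? ((u , v) ∈ₑB?)
  ; ~-sym    = λ (u~v , uv∉B) → ~-sym u~v , uv∉B ∘ Any.map flipₑ
  ; ~-irrefl = λ u≡v → ~-irrefl u≡v ∘ proj₁
  }
  where
  open Graph G
  open EdgeSet B

  _∈ₑB : Vertex × Vertex → Set
  e ∈ₑB = Any (e ≈ₑ_) edges

  _∈ₑB? : U.Decidable _∈ₑB
  (u , v) ∈ₑB? = Any.any? (λ (x , y) →
    ((u ≟ x) ×-dec (v ≟ y)) ⊎-dec ((u ≟ y) ×-dec (v ≟ x))) edges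

  flipₑ : ∀ {u v : Vertex} {e} → (v , u) ≈ₑ e → (u , v) ≈ₑ e
  flipₑ (inj₁ (p , q)) = inj₂ (q , p)
  flipₑ (inj₂ (p , q)) = inj₁ (q , p)

IsEdgeCut : ℕ → (G : Graph) → EdgeSet G → Set
IsEdgeCut h G B = Disconnected (G - B) × MinDegreeAtLeast (G - B) h

-- λₛ⁽ʰ⁾(G) is only defined when an h-edge-cut exists, so "λₛ⁽ʰ⁾(G) = m" is a
-- relation: m is attained by some h-edge-cut and is a lower bound for all.
SuperEdgeConnectivity : ℕ → Graph → ℕ → Set
SuperEdgeConnectivity h G m =
  (Σ[ B ∈ EdgeSet G ] IsEdgeCut h G B × EdgeSet.size B ≡ m) ×
  (∀ (B : EdgeSet G) → IsEdgeCut h G B → m ≤ EdgeSet.size B)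

-- The distinctness proof is irrelevant, so that two k-permutations are equal
-- as soon as their entries are. Fin n plays the role of {1 , … , n}.
P : ℕ → ℕ → Set
P n k = [ p ∈ Vec (Fin n) k ∣ Vec.Unique p ]

module _ {n k : ℕ} where

  unique? : U.Decidable (Vec.Unique {A = Fin n} {k})
  unique? = VecAllPairs.allPairs? λ x y → ¬? (x Fin.≟ y)

  _≟ᴾ_ : DecidableEquality (P n k)
  p ≟ᴾ q = Dec.map′ value-injective (cong value)
                    (Vec.≡-dec Fin._≟_ (value p) (value q))

  unique-value : (p : P n k) → Vec.Unique (value p)
  unique-value (p , [ p! ]) = recompute (unique? p) p!

module _ {A : Set} {Q : A → Set} (Q? : U.Decidable Q) where

  refineList : List A → List [ x ∈ A ∣ Q x ]
  refineList []       = []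
  refineList (x ∷ xs) with Q? x
  ... | yes q = (x , [ q ]) ∷ refineList xs
  ... | no  _ = refineList xs

  refineList-∈ : ∀ {xs} (y : [ x ∈ A ∣ Q x ]) → value y ∈ xs → y ∈ refineList xs
  refineList-∈ {x ∷ _} (y , [ q ]) y∈ with Q? x | y∈
  ... | yes _ | here refl = here refl
  ... | yes _ | there y∈xs = there (refineList-∈ (y , [ q ]) y∈xs)
  ... | no ¬q | here refl = contradiction (recompute (Q? y) q) ¬q
  ... | no _  | there y∈xs = refineList-∈ (y , [ q ]) y∈xs

  refineList-All : ∀ {R : A → Set} {xs} → All R xs → All (R ∘ value) (refineList xs)
  refineList-All {xs = []}    []       = []
  refineList-All {xs = x ∷ _} (r ∷ rs) with Q? x
  ... | yes _ = r ∷ refineList-All rs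
  ... | no  _ = refineList-All rs

  refineList-unique : ∀ {xs} → Unique xs → Unique (refineList xs)
  refineList-unique {[]}    []         = []
  refineList-unique {x ∷ _} (x∉ ∷ xs!) with Q? x
  ... | yes _ = All.map (_∘ cong value) (refineList-All x∉) ∷ refineList-unique xs!
  ... | no  _ = refineList-unique xs!

allVecs : ∀ n k → List (Vec (Fin n) k)
allVecs n zero    = [] ∷ []
allVecs n (suc k) = cartesianProductWith _∷_ (allFin n) (allVecs n k)

allVecs-complete : ∀ {n k} (v : Vec (Fin n) k) → v ∈ allVecs n k
allVecs-complete []       = here refl
allVecs-complete (x ∷ xs) =
  ∈-cartesianProductWith⁺ _∷_ (∈-allFin x) (allVecs-complete xs)

allVecs-unique : ∀ n k → Unique (allVecs n k)
allVecs-unique n zero    = [] ∷ []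
allVecs-unique n (suc k) =
  cartesianProductWith⁺ _∷_ Vec.∷-injective (allFin⁺ n) (allVecs-unique n k)

-- The index i : Fin k points into the tail p₂ … pₖ₊₁, so it ranges over the
-- positions other than the first.
swapFirst : ∀ {A : Set} {k} → Fin k → Vec A (suc k) → Vec A (suc k)
swapFirst i (x ∷ xs) = lookup xs i ∷ (xs [ i ]≔ x)

replaceFirst : ∀ {A : Set} {k} → A → Vec A (suc k) → Vec A (suc k)
replaceFirst α (x ∷ xs) = α ∷ xs

data StarAdjacent {n : ℕ} : ∀ {k} → Rel (Vec (Fin n) k) 0ℓ where
  swap    : ∀ {k} {p q : Vec (Fin n) (suc k)} (i : Fin k) →
            q ≡ swapFirst i p → StarAdjacent p q
  replace : ∀ {k} {p q : Vec (Fin n) (suc k)} (α : Fin n) → α ∉ᵛ p →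
            q ≡ replaceFirst α p → StarAdjacent p q

swapFirst-involutive : ∀ {A : Set} {k} (i : Fin k) (p : Vec A (suc k)) →
                       p ≡ swapFirst i (swapFirst i p)
swapFirst-involutive i (x ∷ xs) = cong₂ _∷_
  (sym (Vec.lookup∘updateAt i xs))
  (begin
    xs                               ≡⟨ Vec.[]≔-lookup xs i ⟨
    xs [ i ]≔ lookup xs i            ≡⟨ Vec.[]≔-idempotent xs i ⟨
    (xs [ i ]≔ x) [ i ]≔ lookup xs i ∎)
  where open ≡-Reasoning

head∉tail : ∀ {A : Set} {k x} {xs : Vec A k} → Vec.Unique (x ∷ xs) → x ∉ᵛ xs
head∉tail (x∉xs VecAllPairs.∷ _) x∈xs = VecAll.lookup x∉xs x∈xs refl

StarAdjacent? : ∀ {n k} → Decidable (StarAdjacent {n} {k})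
StarAdjacent? {k = zero}  p q = no λ ()
StarAdjacent? {k = suc k} p q = Dec.map′
  Sum.[ (λ (i , eq) → swap i eq) , (λ (α , α∉p , eq) → replace α α∉p eq) ]
  (λ where (swap i eq)        → inj₁ (i , eq)
           (replace α α∉p eq) → inj₂ (α , α∉p , eq))
  (Fin.any? (λ i → q ≟ swapFirst i p) ⊎-dec
   Fin.any? (λ α → ¬? (α ∈? p) ×-dec (q ≟ replaceFirst α p)))
  where
  open DecMembership Fin._≟_ using (_∈?_)
  _≟_ = Vec.≡-dec Fin._≟_

StarAdjacent-sym : ∀ {n k} {p q : Vec (Fin n) k} → Vec.Unique p →
                   StarAdjacent p q → StarAdjacent q p
StarAdjacent-sym {p = p}      _  (swap i refl)        = swap i (swapFirst-involutive i p)
StarAdjacent-sym {p = x ∷ xs} p! (replace α α∉p refl) = replace x x∉αxs refl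
  where
  x∉αxs : x ∉ᵛ (α ∷ xs)
  x∉αxs (VecAny.here x≡α)   = α∉p (VecAny.here (sym x≡α))
  x∉αxs (VecAny.there x∈xs) = head∉tail p! x∈xs

StarAdjacent-irrefl : ∀ {n k} {p : Vec (Fin n) k} → Vec.Unique p → ¬ StarAdjacent p p
StarAdjacent-irrefl {p = x ∷ xs} p! (swap i eq)
  with refl ← Vec.∷-injectiveˡ eq = head∉tail p! (∈-lookup i xs)
StarAdjacent-irrefl {p = x ∷ xs} p! (replace α α∉p eq) =
  α∉p (VecAny.here (sym (Vec.∷-injectiveˡ eq)))

S : ℕ → ℕ → Graph
S n k = record
  { Vertex   = P n k
  ; _≟_      = _≟ᴾ_
  ; vertices = refineList unique? (allVecs n k)
  ; unique   = refineList-unique unique? (allVecs-unique n k)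
  ; complete = λ p → refineList-∈ unique? p (allVecs-complete (value p))
  ; _~_      = λ p q → StarAdjacent (value p) (value q)
  ; _~?_     = λ p q → StarAdjacent? (value p) (value q)
  ; ~-sym    = λ {p} → StarAdjacent-sym (unique-value p)
  ; ~-irrefl = λ { {p} refl → StarAdjacent-irrefl (unique-value p) }
  }

{-# OPTIONS --safe #-}

-- Write m = n - k + 1 for the size of the cliques formed by the vertices with
-- a common tail p₂ … pₖ. Splitting the vertices by the symbol p₂ gives n copies
-- of the (n-1, k-1)-star graph, with the same m, joined by the edges swapping
-- p₁ and p₂; of these each vertex has exactly one. By induction on k, a set of
-- x ≤ m vertices has at least x (n - x) boundary edges, and a set X such that X
-- and its complement both have at least m vertices has at least m (n - m). A
-- side of an h-edge-cut has more than h vertices, so that the cut has at least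
-- min { x (n - x) : h < x ≤ m } edges. By concavity the minimum is at x = h + 1
-- or at x = m, where it is attained by the boundary of x vertices of a clique.
module Submission where

open import Defs
open import Data.Bool.Base using (Bool; true; false; not; if_then_else_)
open import Data.Fin.Base as Fin using (Fin; _↑ˡ_; _↑ʳ_; splitAt; join; combine)
import Data.Fin.Properties as Fin
open import Data.Irrelevant using ([_])
open import Data.List.Base
  using (List; []; _∷_; _++_; map; concatMap; allFin; cartesianProduct; cartesianProductWith; length; filter)
import Data.List.Properties as List
open import Data.List.Membership.Propositional using (_∈_)
open import Data.List.Membership.Propositional.Properties
  using (∈-allFin; ∈-++⁻; ∈-map⁺; ∈-map⁻; ∈-concatMap⁻; ∈-cartesianProduct⁺; ∈-cartesianProductWith⁻;
         ∈-filter⁺; ∈-filter⁻)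
open import Data.List.Relation.Unary.All as All using (All; []; _∷_)
import Data.List.Relation.Unary.All.Properties as All
open import Data.List.Relation.Unary.AllPairs as AllPairs using (AllPairs; []; _∷_)
import Data.List.Relation.Unary.AllPairs.Properties as AllPairs
open import Data.List.Relation.Unary.Any as Any using (Any; here; there; _─_)
import Data.List.Relation.Unary.Any.Properties as Any
open import Data.List.Relation.Unary.Unique.Propositional using (Unique)
open import Data.List.Relation.Unary.Unique.Propositional.Properties
  using (allFin⁺; filter⁺; cartesianProduct⁺; cartesianProductWith⁺)
open import Data.Nat.Base
open import Data.Nat.ListAction using (sum)
open import Data.Nat.ListAction.Properties using (sum-++)
open import Data.Nat.Properties
open import Data.Nat.Tactic.RingSolver using (solve-∀)
open import Data.Product.Base using (_×_; _,_; proj₁; proj₂; ∃-syntax)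
open import Data.Refinement using (_,_; value; value-injective)
open import Data.Sum.Base using (_⊎_; inj₁; inj₂)
open import Data.Vec.Base as Vec using (Vec; []; _∷_)
import Data.Vec.Membership.DecPropositional as DecMembership
open import Data.Vec.Membership.Propositional using () renaming (_∈_ to _∈ᵛ_; _∉_ to _∉ᵛ_)
open import Data.Vec.Membership.Propositional.Properties using (∈-lookup; ∈-tabulate⁺; ∈-toList⁺)
import Data.Vec.Properties as Vec
import Data.Vec.Relation.Unary.All as VecAll
import Data.Vec.Relation.Unary.All.Properties as VecAll
import Data.Vec.Relation.Unary.AllPairs as VecAllPairs
import Data.Vec.Relation.Unary.Any as VecAny
import Data.Vec.Relation.Unary.Any.Properties as VecAny
import Data.Vec.Relation.Unary.Unique.Propositional as Vec using (Unique)
import Data.Vec.Relation.Unary.Unique.Propositional.Properties as VecUnique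
open import Function.Base using (_∘_)
open import Level using (0ℓ)
open import Relation.Binary.Construct.Closure.ReflexiveTransitive using (Star; ε; _◅_; _◅◅_)
open import Relation.Binary.Core using (Rel)
open import Relation.Binary.PropositionalEquality
open import Relation.Nullary using (¬_; yes; no; Dec; does)
open import Relation.Nullary.Decidable
  using (¬?; _×-dec_; _⊎-dec_; decidable-stable; ¬¬-excluded-middle; dec-true; dec-false)
open import Relation.Nullary.Negation using (contradiction)
import Relation.Unary as U

-- Finite sums

-- The graph is regular of degree n - 1, so x (n - x) is exactly the boundary of x pairwise adjacent
-- vertices: the bound says that no small set does better than a piece of a clique. Fixing p₂ lowers
-- n by one and keeps m, so the induction has to recover x edges for a small set and m edges for a
-- large one. The large case is the harder one, because the set may be spread over the parts in any
-- way. If every part is nearly pure, there are few edges inside the parts, and those between parts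
-- of opposite majority must be counted. The parts use different symbols. To avoid relabelling, all
-- of them are kept over the fixed type `Fin n`, with the alphabet given by a 0-1 function `A` and
-- vertex sets by 0-1 weights on all words. Sums over words then carry no validity proofs, since
-- invalid words weigh 0.

∑ : {A : Set} → List A → (A → ℕ) → ℕ
∑ xs f = sum (map f xs)

module _ {A : Set} where

  ∑-cong : {f g : A → ℕ} → (∀ x → f x ≡ g x) → ∀ xs → ∑ xs f ≡ ∑ xs g
  ∑-cong f≗g xs = cong sum (List.map-cong f≗g xs)

  ∑-mono : {f g : A → ℕ} → (∀ x → f x ≤ g x) → ∀ xs → ∑ xs f ≤ ∑ xs g
  ∑-mono f≤g []       = z≤n
  ∑-mono f≤g (x ∷ xs) = +-mono-≤ (f≤g x) (∑-mono f≤g xs)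

  ∑-zero : {f : A → ℕ} → (∀ x → f x ≡ 0) → ∀ xs → ∑ xs f ≡ 0
  ∑-zero f≗0 []       = refl
  ∑-zero f≗0 (x ∷ xs) = cong₂ _+_ (f≗0 x) (∑-zero f≗0 xs)

  ∑-+ : ∀ (f g : A → ℕ) xs → ∑ xs (λ x → f x + g x) ≡ ∑ xs f + ∑ xs g
  ∑-+ f g []       = refl
  ∑-+ f g (x ∷ xs) = trans (cong (f x + g x +_) (∑-+ f g xs)) (rearrange (f x) (g x) _ _)
    where
    rearrange : ∀ a b c d → a + b + (c + d) ≡ a + c + (b + d)
    rearrange = solve-∀

  ∑-*ˡ : ∀ c (f : A → ℕ) xs → ∑ xs (λ x → c * f x) ≡ c * ∑ xs f
  ∑-*ˡ c f []       = sym (*-zeroʳ c)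
  ∑-*ˡ c f (x ∷ xs) = trans (cong (c * f x +_) (∑-*ˡ c f xs)) (sym (*-distribˡ-+ c _ _))

  ∑-*ʳ : ∀ c (f : A → ℕ) xs → ∑ xs (λ x → f x * c) ≡ ∑ xs f * c
  ∑-*ʳ c f xs = trans (∑-cong (λ x → *-comm (f x) c) xs) (trans (∑-*ˡ c f xs) (*-comm c _))

  ∑-++ : ∀ (f : A → ℕ) xs ys → ∑ (xs ++ ys) f ≡ ∑ xs f + ∑ ys f
  ∑-++ f xs ys = trans (cong sum (List.map-++ f xs ys)) (sum-++ (map f xs) (map f ys))

  ∈⇒≤∑ : ∀ (f : A → ℕ) {x xs} → x ∈ xs → f x ≤ ∑ xs f
  ∈⇒≤∑ f (here refl)  = m≤m+n _ _
  ∈⇒≤∑ f (there x∈xs) = m≤n⇒m≤o+n _ (∈⇒≤∑ f x∈xs)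

  ∑≤length-filter : ∀ {f : A → ℕ} → (∀ x → f x ≤ 1) → ∀ xs →
                    ∑ xs f ≤ length (filter (λ x → 1 ≤? f x) xs)
  ∑≤length-filter f≤1 []       = z≤n
  ∑≤length-filter {f} f≤1 (x ∷ xs) with 1 ≤? f x
  ... | yes 1≤fx rewrite List.filter-accept (λ x → 1 ≤? f x) {xs = xs} 1≤fx =
    +-mono-≤ (f≤1 x) (∑≤length-filter f≤1 xs)
  ... | no fx≱1 rewrite List.filter-reject (λ x → 1 ≤? f x) {xs = xs} fx≱1 | n<1⇒n≡0 (≰⇒> fx≱1) =
    ∑≤length-filter f≤1 xs

  length-filter≤∑ : ∀ (f : A → ℕ) xs → length (filter (λ x → 1 ≤? f x) xs) ≤ ∑ xs f
  length-filter≤∑ f []       = z≤n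
  length-filter≤∑ f (x ∷ xs) with 1 ≤? f x
  ... | yes 1≤fx rewrite List.filter-accept (λ x → 1 ≤? f x) {xs = xs} 1≤fx =
    +-mono-≤ 1≤fx (length-filter≤∑ f xs)
  ... | no fx≱1 rewrite List.filter-reject (λ x → 1 ≤? f x) {xs = xs} fx≱1 =
    m≤n⇒m≤o+n _ (length-filter≤∑ f xs)

module _ {A B : Set} where

  ∑-map : ∀ (g : A → B) (f : B → ℕ) xs → ∑ (map g xs) f ≡ ∑ xs (f ∘ g)
  ∑-map g f xs = cong sum (sym (List.map-∘ xs))

  ∑-concatMap : ∀ (g : A → List B) (f : B → ℕ) xs →
                ∑ (concatMap g xs) f ≡ ∑ xs (λ x → ∑ (g x) f)
  ∑-concatMap g f []       = refl
  ∑-concatMap g f (x ∷ xs) = trans (∑-++ f (g x) _) (cong (∑ (g x) f +_) (∑-concatMap g f xs))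

  ∑-comm : ∀ (f : A → B → ℕ) xs ys →
           ∑ xs (λ x → ∑ ys (f x)) ≡ ∑ ys (λ y → ∑ xs (λ x → f x y))
  ∑-comm f []       ys = sym (∑-zero (λ _ → refl) ys)
  ∑-comm f (x ∷ xs) ys = trans (cong (∑ ys (f x) +_) (∑-comm f xs ys))
                               (sym (∑-+ (f x) (λ y → ∑ xs (λ z → f z y)) ys))

∑-cartesianProductWith : ∀ {A B C : Set} (h : A → B → C) (f : C → ℕ) xs ys →
  ∑ (cartesianProductWith h xs ys) f ≡ ∑ xs (λ x → ∑ ys (λ y → f (h x y)))
∑-cartesianProductWith h f []       ys = refl
∑-cartesianProductWith h f (x ∷ xs) ys =
  trans (∑-++ f (map (h x) ys) _)
        (cong₂ _+_ (∑-map (h x) f ys) (∑-cartesianProductWith h f xs ys))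

module _ {n : ℕ} where

  infix 8 _∖_
  -- Serves both to leave out one term of a sum and to remove a used letter from an alphabet.
  _∖_ : (Fin n → ℕ) → Fin n → Fin n → ℕ
  (f ∖ i) j with j Fin.≟ i
  ... | yes _ = 0
  ... | no  _ = f j

  ∖-self : ∀ f i → (f ∖ i) i ≡ 0
  ∖-self f i with i Fin.≟ i
  ... | yes _  = refl
  ... | no i≢i = contradiction refl i≢i

  ∖-other : ∀ f {i j} → j ≢ i → (f ∖ i) j ≡ f j
  ∖-other f {i} {j} j≢i with j Fin.≟ i
  ... | yes j≡i = contradiction j≡i j≢i
  ... | no _    = refl

  ∖≤ : ∀ f i j → (f ∖ i) j ≤ f j
  ∖≤ f i j with j Fin.≟ i
  ... | yes _ = z≤n
  ... | no  _ = ≤-refl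

  ∖-cong : ∀ {f g} → (∀ j → f j ≡ g j) → ∀ i j → (f ∖ i) j ≡ (g ∖ i) j
  ∖-cong f≗g i j with j Fin.≟ i
  ... | yes _ = refl
  ... | no  _ = f≗g j

  ∖-comm : ∀ f i j l → ((f ∖ i) ∖ j) l ≡ ((f ∖ j) ∖ i) l
  ∖-comm f i j l with l Fin.≟ i in eqᵢ | l Fin.≟ j in eqⱼ
  ... | yes _ | yes _ = refl
  ... | yes _ | no  _ rewrite eqᵢ = refl
  ... | no  _ | yes _ rewrite eqⱼ = refl
  ... | no  _ | no  _ rewrite eqᵢ | eqⱼ = refl

  ∑-absent : ∀ f {i xs} → All (i ≢_) xs → ∑ xs (f ∖ i) ≡ ∑ xs f
  ∑-absent f []           = refl
  ∑-absent f (i≢x ∷ i∉xs) = cong₂ _+_ (∖-other f (≢-sym i≢x)) (∑-absent f i∉xs)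

  ∑-∖′ : ∀ f {i xs} → Unique xs → i ∈ xs → ∑ xs f ≡ f i + ∑ xs (f ∖ i)
  ∑-∖′ f {i} (i∉xs ∷ _) (here refl) =
    cong (f i +_) (sym (cong₂ _+_ (∖-self f i) (∑-absent f i∉xs)))
  ∑-∖′ f {i} {x ∷ xs} (x∉xs ∷ xs!) (there i∈xs) = begin
    f x + ∑ xs f                     ≡⟨ cong (f x +_) (∑-∖′ f xs! i∈xs) ⟩
    f x + (f i + ∑ xs (f ∖ i))       ≡⟨ rearrange (f x) (f i) _ ⟩
    f i + (f x + ∑ xs (f ∖ i))       ≡⟨ cong (λ z → f i + (z + _)) (∖-other f (All.lookup x∉xs i∈xs)) ⟨
    f i + ((f ∖ i) x + ∑ xs (f ∖ i)) ∎
    where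
    open ≡-Reasoning
    rearrange : ∀ a b c → a + (b + c) ≡ b + (a + c)
    rearrange = solve-∀

  Σᶠ : (Fin n → ℕ) → ℕ
  Σᶠ = ∑ (allFin n)

  Σᵛ : ∀ k → (Vec (Fin n) k → ℕ) → ℕ
  Σᵛ k = ∑ (allVecs n k)

  Σᶠ-∖ : ∀ f i → Σᶠ f ≡ f i + Σᶠ (f ∖ i)
  Σᶠ-∖ f i = ∑-∖′ f (allFin⁺ n) (∈-allFin i)

  ≤Σᶠ : ∀ f i → f i ≤ Σᶠ f
  ≤Σᶠ f i = ∈⇒≤∑ f (∈-allFin i)

  ≤Σᶠ₂ : ∀ f {i j} → j ≢ i → f i + f j ≤ Σᶠ f
  ≤Σᶠ₂ f {i} {j} j≢i = begin
    f i + f j       ≡⟨ cong (f i +_) (∖-other f j≢i) ⟨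
    f i + (f ∖ i) j ≤⟨ +-monoʳ-≤ (f i) (≤Σᶠ (f ∖ i) j) ⟩
    f i + Σᶠ (f ∖ i) ≡⟨ Σᶠ-∖ f i ⟨
    Σᶠ f            ∎
    where open ≤-Reasoning

  Σᵛ-∷ : ∀ k F → Σᵛ (suc k) F ≡ Σᶠ (λ x → Σᵛ k (λ xs → F (x ∷ xs)))
  Σᵛ-∷ k F = ∑-cartesianProductWith _∷_ F (allFin n) (allVecs n k)

  insertSecond : ∀ {k} → Fin n → Vec (Fin n) (suc k) → Vec (Fin n) (2 + k)
  insertSecond i (x ∷ xs) = x ∷ i ∷ xs

  Σᵛ-∷∷ : ∀ k F → Σᵛ (2 + k) F ≡ Σᶠ (λ x → Σᶠ (λ i → Σᵛ k (λ xs → F (x ∷ i ∷ xs))))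
  Σᵛ-∷∷ k F = trans (Σᵛ-∷ (suc k) F) (∑-cong (λ x → Σᵛ-∷ k (λ v → F (x ∷ v))) (allFin n))

  Σᵛ-insertSecond : ∀ k F → Σᵛ (2 + k) F ≡ Σᶠ (λ i → Σᵛ (suc k) (F ∘ insertSecond i))
  Σᵛ-insertSecond k F = begin
    Σᵛ (2 + k) F
      ≡⟨ Σᵛ-∷∷ k F ⟩
    Σᶠ (λ x → Σᶠ (λ i → Σᵛ k (λ xs → F (x ∷ i ∷ xs))))
      ≡⟨ ∑-comm _ (allFin n) (allFin n) ⟩
    Σᶠ (λ i → Σᶠ (λ x → Σᵛ k (λ xs → F (x ∷ i ∷ xs))))
      ≡⟨ ∑-cong (λ i → Σᵛ-∷ k (F ∘ insertSecond i)) (allFin n) ⟨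
    Σᶠ (λ i → Σᵛ (suc k) (F ∘ insertSecond i)) ∎
    where open ≡-Reasoning

  exchange : ∀ {k} → Vec (Fin n) (2 + k) → Vec (Fin n) (2 + k)
  exchange = swapFirst Fin.zero

  Σᵛ-exchange : ∀ k F → Σᵛ (2 + k) (F ∘ exchange) ≡ Σᵛ (2 + k) F
  Σᵛ-exchange k F = trans (Σᵛ-∷∷ k _) (trans (∑-comm _ (allFin n) (allFin n)) (sym (Σᵛ-∷∷ k F)))

≤1-cases : ∀ {a} → a ≤ 1 → a ≡ 0 ⊎ a ≡ 1
≤1-cases z≤n       = inj₁ refl
≤1-cases (s≤s z≤n) = inj₂ refl

-- Validity of partial permutations

module _ {n : ℕ} where

  -- A is the indicator function of the symbols that may be used; W A is then
  -- the indicator function of the words with distinct letters among those.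
  W : (Fin n → ℕ) → ∀ {k} → Vec (Fin n) k → ℕ
  W A []       = 1
  W A (x ∷ xs) = A x * W (A ∖ x) xs

  W-cong : ∀ {A B} → (∀ j → A j ≡ B j) → ∀ {k} (v : Vec (Fin n) k) → W A v ≡ W B v
  W-cong A≗B []       = refl
  W-cong A≗B (x ∷ xs) = cong₂ _*_ (A≗B x) (W-cong (∖-cong A≗B x) xs)

  W≤1 : ∀ {A} → (∀ j → A j ≤ 1) → ∀ {k} (v : Vec (Fin n) k) → W A v ≤ 1
  W≤1 A≤1 []           = ≤-refl
  W≤1 {A} A≤1 (x ∷ xs) =
    *-mono-≤ (A≤1 x) (W≤1 (λ j → ≤-trans (∖≤ A x j) (A≤1 j)) xs)

  W-repeat : ∀ A x {k} (xs : Vec (Fin n) k) → W A (x ∷ x ∷ xs) ≡ 0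
  W-repeat A x xs rewrite ∖-self A x = *-zeroʳ (A x)

  W-distinct : ∀ A {x i k} (xs : Vec (Fin n) k) → i ≢ x →
               W A (x ∷ i ∷ xs) ≡ A x * (A i * W ((A ∖ x) ∖ i) xs)
  W-distinct A {x} {i} xs i≢x = cong (λ a → A x * (a * W ((A ∖ x) ∖ i) xs)) (∖-other A i≢x)

  W-exchange : ∀ A {k} (v : Vec (Fin n) (2 + k)) → W A (exchange v) ≡ W A v
  W-exchange A (x ∷ i ∷ xs) = lemma (x Fin.≟ i)
    where
    open ≡-Reasoning
    rearrange : ∀ a b c → a * (b * c) ≡ b * (a * c)
    rearrange = solve-∀
    lemma : Dec (x ≡ i) → W A (i ∷ x ∷ xs) ≡ W A (x ∷ i ∷ xs)
    lemma (yes refl) = refl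
    lemma (no x≢i)   = begin
      W A (i ∷ x ∷ xs)                  ≡⟨ W-distinct A xs x≢i ⟩
      A i * (A x * W ((A ∖ i) ∖ x) xs)  ≡⟨ cong (λ w → A i * (A x * w)) (W-cong (∖-comm A i x) xs) ⟩
      A i * (A x * W ((A ∖ x) ∖ i) xs)  ≡⟨ rearrange (A i) (A x) _ ⟩
      A x * (A i * W ((A ∖ x) ∖ i) xs)  ≡⟨ W-distinct A xs (≢-sym x≢i) ⟨
      W A (x ∷ i ∷ xs)                  ∎

  W-insertSecond : ∀ A i {k} (v : Vec (Fin n) (suc k)) →
                   W A (insertSecond i v) ≡ A i * W (A ∖ i) v
  W-insertSecond A i (x ∷ xs) = W-exchange A (i ∷ x ∷ xs)

  Σᶠ-remove : ∀ {A : Fin n → ℕ} {i l} → A i ≡ 1 → Σᶠ A ≡ suc l → Σᶠ (A ∖ i) ≡ l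
  Σᶠ-remove {A} {i} Aᵢ≡1 ΣA = suc-injective
    (trans (cong (_+ Σᶠ (A ∖ i)) (sym Aᵢ≡1)) (trans (sym (Σᶠ-∖ A i)) ΣA))

  ΣW-∷ : ∀ A k → Σᵛ (suc k) (W A) ≡ Σᶠ (λ x → A x * Σᵛ k (W (A ∖ x)))
  ΣW-∷ A k = trans (Σᵛ-∷ k (W A)) (∑-cong (λ x → ∑-*ˡ (A x) (W (A ∖ x)) (allVecs n k)) (allFin n))

  mutual
    ΣW-positive : ∀ k {A} → (∀ j → A j ≤ 1) → k ≤ Σᶠ A → 1 ≤ Σᵛ k (W A)
    ΣW-positive zero    A≤1 _    = ≤-refl
    ΣW-positive (suc k) A≤1 k<ΣA = ≤-trans (≤-trans (s≤s z≤n) k<ΣA) (ΣA≤ΣW k A≤1 k<ΣA)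

    -- Every usable first letter leaves at least `k` symbols, enough to complete the word. Of the
    -- falling factorial only the first factor is kept; this suffices for counting the edges between
    -- two parts.
    ΣA≤ΣW : ∀ k {A} → (∀ j → A j ≤ 1) → suc k ≤ Σᶠ A → Σᶠ A ≤ Σᵛ (suc k) (W A)
    ΣA≤ΣW k {A} A≤1 k<ΣA = begin
      Σᶠ A                                ≤⟨ ∑-mono term (allFin n) ⟩
      Σᶠ (λ x → A x * Σᵛ k (W (A ∖ x)))   ≡⟨ ΣW-∷ A k ⟨
      Σᵛ (suc k) (W A)                    ∎
      where
      open ≤-Reasoning
      term : ∀ x → A x ≤ A x * Σᵛ k (W (A ∖ x))
      term x with ≤1-cases (A≤1 x)
      ... | inj₁ Ax≡0 rewrite Ax≡0 = z≤n
      ... | inj₂ Ax≡1 = begin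
        A x                        ≡⟨ *-identityʳ (A x) ⟨
        A x * 1                    ≤⟨ *-monoʳ-≤ (A x) (ΣW-positive k (λ j → ≤-trans (∖≤ A x j) (A≤1 j)) k≤) ⟩
        A x * Σᵛ k (W (A ∖ x))     ∎
        where
        k≤ : k ≤ Σᶠ (A ∖ x)
        k≤ = s≤s⁻¹ (subst (suc k ≤_) (trans (Σᶠ-∖ A x) (cong (_+ Σᶠ (A ∖ x)) Ax≡1)) k<ΣA)

-- Counting edges between two sets of vertices

  insertBoth : ∀ {k} → Fin n → Vec (Fin n) (suc k) × Vec (Fin n) (suc k) →
               Vec (Fin n) (2 + k) × Vec (Fin n) (2 + k)
  insertBoth i (u , v) = insertSecond i u , insertSecond i v

  -- Vertex sets are given by indicator functions X, Y on all words, so that the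
  -- pairs below that contain an invalid word or form a loop have weight 0.
  edges : ∀ k → List (Vec (Fin n) (suc k) × Vec (Fin n) (suc k))
  edges zero    = cartesianProductWith (λ x y → x ∷ [] , y ∷ []) (allFin n) (allFin n)
  edges (suc k) =
    concatMap (λ i → map (insertBoth i) (edges k)) (allFin n)
    ++ map (λ v → v , exchange v) (allVecs n (2 + k))

  -- `edges` lists every edge in both directions, so for disjoint sets `X` and `Y` of valid words
  -- each edge between them is counted exactly once.
  e : ∀ k (X Y : Vec (Fin n) (suc k) → ℕ) → ℕ
  e k X Y = ∑ (edges k) (λ (u , v) → X u * Y v)

  cross : ∀ k (X Y : Vec (Fin n) (2 + k) → ℕ) → ℕ
  cross k X Y = Σᵛ (2 + k) (λ v → X v * Y (exchange v))

  inside : ∀ k (X Y : Vec (Fin n) (2 + k) → ℕ) → Fin n → ℕ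
  inside k X Y i = e k (X ∘ insertSecond i) (Y ∘ insertSecond i)

  part : ∀ k → (Vec (Fin n) (2 + k) → ℕ) → Fin n → ℕ
  part k X i = Σᵛ (suc k) (X ∘ insertSecond i)

  Σᵛ-single : ∀ F → Σᵛ 1 F ≡ Σᶠ (λ x → F (x ∷ []))
  Σᵛ-single F = trans (Σᵛ-∷ 0 F) (∑-cong (λ x → +-identityʳ (F (x ∷ []))) (allFin n))

  e-zero : ∀ X Y → e 0 X Y ≡ Σᵛ 1 X * Σᵛ 1 Y
  e-zero X Y = begin
    e 0 X Y
      ≡⟨ ∑-cartesianProductWith _ _ (allFin n) (allFin n) ⟩
    Σᶠ (λ x → Σᶠ (λ y → X (x ∷ []) * Y (y ∷ [])))
      ≡⟨ ∑-cong (λ x → ∑-*ˡ (X (x ∷ [])) (λ y → Y (y ∷ [])) (allFin n)) (allFin n) ⟩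
    Σᶠ (λ x → X (x ∷ []) * Σᶠ (λ y → Y (y ∷ [])))
      ≡⟨ ∑-*ʳ _ (λ x → X (x ∷ [])) (allFin n) ⟩
    Σᶠ (λ x → X (x ∷ [])) * Σᶠ (λ y → Y (y ∷ []))
      ≡⟨ cong₂ _*_ (Σᵛ-single X) (Σᵛ-single Y) ⟨
    Σᵛ 1 X * Σᵛ 1 Y ∎
    where open ≡-Reasoning

  e-suc : ∀ k X Y → e (suc k) X Y ≡ Σᶠ (inside k X Y) + cross k X Y
  e-suc k X Y = trans
    (∑-++ _ (concatMap _ (allFin n)) _)
    (cong₂ _+_
      (trans (∑-concatMap _ _ (allFin n)) (∑-cong (λ i → ∑-map _ _ (edges k)) (allFin n)))
      (∑-map _ _ (allVecs n (2 + k))))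

  exchange-involutive : ∀ {k} (v : Vec (Fin n) (2 + k)) → exchange (exchange v) ≡ v
  exchange-involutive v = sym (swapFirst-involutive Fin.zero v)

  cross-comm : ∀ k X Y → cross k X Y ≡ cross k Y X
  cross-comm k X Y = trans (sym (Σᵛ-exchange k (λ v → X v * Y (exchange v)))) (∑-cong term (allVecs n (2 + k)))
    where
    term : ∀ v → X (exchange v) * Y (exchange (exchange v)) ≡ Y v * X (exchange v)
    term v rewrite exchange-involutive v = *-comm (X (exchange v)) (Y v)

  e-comm : ∀ k X Y → e k X Y ≡ e k Y X
  e-comm zero    X Y = trans (e-zero X Y) (trans (*-comm (Σᵛ 1 X) _) (sym (e-zero Y X)))
  e-comm (suc k) X Y = trans (e-suc k X Y) (trans
    (cong₂ _+_ (∑-cong (λ i → e-comm k (X ∘ insertSecond i) (Y ∘ insertSecond i)) (allFin n)) (cross-comm k X Y))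
    (sym (e-suc k Y X)))

-- Edges between different parts

  -- Meant for 0-1 weights: `a` marks a vertex of X, while `b` and `c` tell whether its exchange
  -- partner lies in X or in Y.
  covered : ∀ {a b c} → a ≤ 1 → a ≤ b + c → a ≤ a * c + b
  covered z≤n       _     = z≤n
  covered {b = b} {c} (s≤s z≤n) 1≤b+c =
    subst (1 ≤_) (trans (+-comm b c) (cong (_+ b) (sym (+-identityʳ c)))) 1≤b+c

  part-column : ∀ k (X : Vec (Fin n) (2 + k) → ℕ) i x →
                Σᵛ k (λ xs → X (i ∷ x ∷ xs)) ≤ part k X x
  part-column k X i x = subst (Σᵛ k (λ xs → X (i ∷ x ∷ xs)) ≤_) (sym (Σᵛ-∷ k (X ∘ insertSecond x)))
    (≤Σᶠ (λ y → Σᵛ k (λ xs → X (y ∷ x ∷ xs))) i)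

  part-∷ : ∀ k (X : Vec (Fin n) (2 + k) → ℕ) i →
           part k X i ≡ Σᶠ (λ x → Σᵛ k (λ xs → X (x ∷ i ∷ xs)))
  part-∷ k X i = Σᵛ-∷ k (X ∘ insertSecond i)

  cross-parts : ∀ k X Y → cross k X Y ≡
    Σᶠ (λ i → Σᵛ (suc k) (λ v → X (insertSecond i v) * Y (exchange (insertSecond i v))))
  cross-parts k X Y = Σᵛ-insertSecond k (λ v → X v * Y (exchange v))

  module _ {A : Fin n → ℕ} (A≤1 : ∀ j → A j ≤ 1) {k : ℕ}
           (X Y : Vec (Fin n) (2 + k) → ℕ) (X+Y≗W : ∀ v → X v + Y v ≡ W A v) where

    -- The exchange partner of a vertex of part `i` begins with `i`, hence lies in another part. For
    -- a vertex of X the partner is either in Y, giving an edge of `cross`, or in X, where it is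
    -- counted by its own part.
    part≤cross : ∀ i → part k X i ≤ cross k X Y + Σᶠ (part k X ∖ i)
    part≤cross i = begin
      part k X i
        ≤⟨ ∑-mono (λ v → term (insertSecond i v)) (allVecs n (suc k)) ⟩
      Σᵛ (suc k) (λ v → X (insertSecond i v) * Y (exchange (insertSecond i v)) + X (exchange (insertSecond i v)))
        ≡⟨ ∑-+ _ _ (allVecs n (suc k)) ⟩
      Σᵛ (suc k) (λ v → X (insertSecond i v) * Y (exchange (insertSecond i v)))
      + Σᵛ (suc k) (λ v → X (exchange (insertSecond i v)))
        ≤⟨ +-mono-≤ (≤-trans (≤Σᶠ _ i) (≤-reflexive (sym (cross-parts k X Y)))) outside ⟩
      cross k X Y + Σᶠ (part k X ∖ i) ∎
      where
      open ≤-Reasoning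
      term : ∀ v → X v ≤ X v * Y (exchange v) + X (exchange v)
      term v = covered (≤-trans X≤W (W≤1 A≤1 v))
        (subst (X v ≤_) (sym (trans (X+Y≗W (exchange v)) (W-exchange A v))) X≤W)
        where
        X≤W : X v ≤ W A v
        X≤W = subst (X v ≤_) (X+Y≗W v) (m≤m+n _ _)
      column : ∀ x → Σᵛ k (λ xs → X (i ∷ x ∷ xs)) ≤ (part k X ∖ i) x
      column x with x Fin.≟ i
      ... | no _     = part-column k X i x
      -- A word beginning with `i ∷ i` is invalid, so nothing is lost by omitting part `i` on the
      -- right.
      ... | yes refl = ≤-reflexive (∑-zero
        (λ xs → n≤0⇒n≡0 (subst (X (i ∷ i ∷ xs) ≤_) (trans (X+Y≗W _) (W-repeat A i xs)) (m≤m+n _ _)))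
        (allVecs n k))
      outside : Σᵛ (suc k) (λ v → X (exchange (insertSecond i v))) ≤ Σᶠ (part k X ∖ i)
      outside = ≤-trans (≤-reflexive (Σᵛ-∷ k (λ v → X (exchange (insertSecond i v))))) (∑-mono column (allFin n))

    -- α and β select two disjoint sets of parts. Any two parts are joined by at
    -- least M edges, each of which is counted by the cross term unless its end in
    -- α lies in Y or its end in β lies in X.
    module _ {α β : Fin n → ℕ} (α+β≤A : ∀ i → α i + β i ≤ A i) {M : ℕ}
             (M≤ : ∀ {i x} → A i ≡ 1 → A x ≡ 1 → i ≢ x → M ≤ Σᵛ k (W ((A ∖ x) ∖ i))) where

      α≤A : ∀ i → α i ≤ A i
      α≤A i = m+n≤o⇒m≤o (α i) (α+β≤A i)

      β≤A : ∀ i → β i ≤ A i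
      β≤A i = m+n≤o⇒n≤o (α i) (α+β≤A i)

      pairs≤cross : Σᶠ α * Σᶠ β * M ≤
        cross k X Y + (Σᶠ (λ i → α i * part k Y i) + Σᶠ (λ x → β x * part k X x))
      pairs≤cross = begin
        Σᶠ α * Σᶠ β * M
          ≡⟨ cong (_* M) (∑-*ʳ (Σᶠ β) α (allFin n)) ⟨
        Σᶠ (λ i → α i * Σᶠ β) * M
          ≡⟨ ∑-*ʳ M _ (allFin n) ⟨
        Σᶠ (λ i → α i * Σᶠ β * M)
          ≡⟨ ∑-cong (λ i → trans (cong (_* M) (sym (∑-*ˡ (α i) β (allFin n)))) (sym (∑-*ʳ M _ (allFin n)))) (allFin n) ⟩
        Σᶠ (λ i → Σᶠ (λ x → α i * β x * M))
          ≤⟨ ∑-mono (λ i → ∑-mono (λ x → pair i x) (allFin n)) (allFin n) ⟩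
        Σᶠ (λ i → Σᶠ (λ x → cᵢₓ i x + (α i * yᵢₓ i x + β x * xᵢₓ i x)))
          ≡⟨ ∑-cong (λ i → trans (∑-+ _ _ (allFin n)) (cong (Σᶠ (cᵢₓ i) +_) (∑-+ _ _ (allFin n)))) (allFin n) ⟩
        Σᶠ (λ i → Σᶠ (cᵢₓ i) + (Σᶠ (λ x → α i * yᵢₓ i x) + Σᶠ (λ x → β x * xᵢₓ i x)))
          ≡⟨ trans (∑-+ _ _ (allFin n)) (cong (Σᶠ (λ i → Σᶠ (cᵢₓ i)) +_) (∑-+ _ _ (allFin n))) ⟩
        Σᶠ (λ i → Σᶠ (cᵢₓ i))
        + (Σᶠ (λ i → Σᶠ (λ x → α i * yᵢₓ i x)) + Σᶠ (λ i → Σᶠ (λ x → β x * xᵢₓ i x)))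
          ≡⟨ cong₂ _+_ crossSum (cong₂ _+_ (∑-cong αSum (allFin n)) βSum) ⟩
        cross k X Y + (Σᶠ (λ i → α i * part k Y i) + Σᶠ (λ x → β x * part k X x)) ∎
        where
        open ≤-Reasoning
        cᵢₓ yᵢₓ xᵢₓ : Fin n → Fin n → ℕ
        cᵢₓ i x = Σᵛ k (λ xs → X (x ∷ i ∷ xs) * Y (i ∷ x ∷ xs))
        yᵢₓ i x = Σᵛ k (λ xs → Y (x ∷ i ∷ xs))
        xᵢₓ i x = Σᵛ k (λ xs → X (i ∷ x ∷ xs))

        crossSum : Σᶠ (λ i → Σᶠ (cᵢₓ i)) ≡ cross k X Y
        crossSum = trans (∑-cong (λ i → sym (part-∷ k (λ v → X v * Y (exchange v)) i)) (allFin n)) (sym (cross-parts k X Y))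

        αSum : ∀ i → Σᶠ (λ x → α i * yᵢₓ i x) ≡ α i * part k Y i
        αSum i = trans (∑-*ˡ (α i) _ (allFin n)) (cong (α i *_) (sym (part-∷ k Y i)))

        βSum : Σᶠ (λ i → Σᶠ (λ x → β x * xᵢₓ i x)) ≡ Σᶠ (λ x → β x * part k X x)
        βSum = trans (∑-comm _ (allFin n) (allFin n))
          (∑-cong (λ x → trans (∑-*ˡ (β x) _ (allFin n)) (cong (β x *_) (sym (part-∷ k X x)))) (allFin n))

        split : ∀ {a b c d w} → a + b ≡ w → c + d ≡ w → w ≤ 1 → w ≤ a * d + (b + c)
        split {zero} {b} {c} refl _ _ = m≤m+n b c
        split {suc zero} {b} {c} {d} refl c+d (s≤s z≤n) =
          ≤-reflexive (trans (sym c+d) (trans (+-comm c d) (cong (_+ c) (sym (+-identityʳ d)))))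

        pointwise : ∀ i x xs → W A (x ∷ i ∷ xs) ≤
          X (x ∷ i ∷ xs) * Y (i ∷ x ∷ xs) + (Y (x ∷ i ∷ xs) + X (i ∷ x ∷ xs))
        pointwise i x xs = split {X (x ∷ i ∷ xs)} {_} {X (i ∷ x ∷ xs)} (X+Y≗W _)
          (trans (X+Y≗W _) (W-exchange A (x ∷ i ∷ xs))) (W≤1 A≤1 (x ∷ i ∷ xs))

        pair : ∀ i x → α i * β x * M ≤ cᵢₓ i x + (α i * yᵢₓ i x + β x * xᵢₓ i x)
        pair i x with ≤1-cases (≤-trans (α≤A i) (A≤1 i)) | ≤1-cases (≤-trans (β≤A x) (A≤1 x))
        ... | inj₁ αᵢ≡0 | _         rewrite αᵢ≡0 = z≤n
        ... | inj₂ _    | inj₁ βₓ≡0 rewrite βₓ≡0 | *-zeroʳ (α i) = z≤n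
        ... | inj₂ αᵢ≡1 | inj₂ βₓ≡1 rewrite αᵢ≡1 | βₓ≡1 = begin
          M + 0
            ≡⟨ +-identityʳ M ⟩
          M
            ≤⟨ M≤ Aᵢ≡1 Aₓ≡1 i≢x ⟩
          Σᵛ k (W ((A ∖ x) ∖ i))
            ≡⟨ ∑-cong (λ xs → trans (cong₂ (λ a b → a * (b * W ((A ∖ x) ∖ i) xs)) Aₓ≡1 Aᵢ≡1)
                                    (trans (+-identityʳ _) (+-identityʳ _))) (allVecs n k) ⟨
          Σᵛ k (λ xs → A x * (A i * W ((A ∖ x) ∖ i) xs))
            ≡⟨ ∑-cong (λ xs → W-distinct A xs i≢x) (allVecs n k) ⟨
          Σᵛ k (λ xs → W A (x ∷ i ∷ xs))
            ≤⟨ ∑-mono (pointwise i x) (allVecs n k) ⟩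
          Σᵛ k (λ xs → X (x ∷ i ∷ xs) * Y (i ∷ x ∷ xs) + (Y (x ∷ i ∷ xs) + X (i ∷ x ∷ xs)))
            ≡⟨ trans (∑-+ _ _ (allVecs n k)) (cong (cᵢₓ i x +_) (∑-+ _ _ (allVecs n k))) ⟩
          cᵢₓ i x + (yᵢₓ i x + xᵢₓ i x)
            ≡⟨ cong (cᵢₓ i x +_) (cong₂ _+_ (+-identityʳ (yᵢₓ i x)) (+-identityʳ (xᵢₓ i x))) ⟨
          cᵢₓ i x + (yᵢₓ i x + 0 + (xᵢₓ i x + 0)) ∎
          where
          Aᵢ≡1 : A i ≡ 1
          Aᵢ≡1 = ≤-antisym (A≤1 i) (subst (_≤ A i) αᵢ≡1 (α≤A i))
          Aₓ≡1 : A x ≡ 1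
          Aₓ≡1 = ≤-antisym (A≤1 x) (subst (_≤ A x) βₓ≡1 (β≤A x))
          i≢x : i ≢ x
          i≢x refl = <⇒≱ (subst₂ (λ a b → 1 < a + b) (sym αᵢ≡1) (sym βₓ≡1) ≤-refl) (≤-trans (α+β≤A i) (A≤1 i))

-- Isoperimetry

-- This is (a - 1)(b - 1) ≥ 0. It turns the number of parts, split into two nonempty kinds, into a
-- lower bound for the number of pairs of opposite kinds.
a+b≤1+ab : ∀ {a b} → 1 ≤ a → 1 ≤ b → a + b ≤ suc (a * b)
a+b≤1+ab {suc a} {suc b} _ _ = s≤s (subst (a + suc b ≤_) (rearrange a b) (m≤m+n (a + suc b) (a * b)))
  where
  rearrange : ∀ a b → a + suc b + a * b ≡ suc (b + a * suc b)
  rearrange = solve-∀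

thin-bound : ∀ k {m x r} → 1 ≤ x → x + r ≡ m → m ≤ x * (r + suc k)
thin-bound k {m} {x} {r} 1≤x refl = begin
  x + r             ≤⟨ s≤s⁻¹ (subst (_≤ suc (x * suc r)) (+-suc x r) (a+b≤1+ab 1≤x (s≤s z≤n))) ⟩
  x * suc r         ≤⟨ *-monoʳ-≤ x (subst (suc r ≤_) (sym (+-suc r k)) (s≤s (m≤m+n r k))) ⟩
  x * (r + suc k)   ∎
  where open ≤-Reasoning

module _ {n : ℕ} where

  -- With m + k symbols in total, r + k is the number of symbols minus the size
  -- of the small set.
  record Expanding (k m : ℕ) (X Y : Vec (Fin n) (suc k) → ℕ) : Set where
    field
      smallˡ : ∀ r → Σᵛ (suc k) X + r ≡ m → Σᵛ (suc k) X * (r + k) ≤ e k X Y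
      smallʳ : ∀ r → Σᵛ (suc k) Y + r ≡ m → Σᵛ (suc k) Y * (r + k) ≤ e k X Y
      large  : m ≤ Σᵛ (suc k) X → m ≤ Σᵛ (suc k) Y → m * k ≤ e k X Y

  open Expanding

  -- However small the smaller side is, `thin-bound` makes its boundary at least `m`. Two letters
  -- are essential: a vertex of a clique of size `m` has degree only `m - 1`.
  mixed : ∀ {k m X Y} → Expanding (suc k) m X Y →
          1 ≤ Σᵛ (2 + k) X → 1 ≤ Σᵛ (2 + k) Y → m ≤ e (suc k) X Y
  mixed {k} {m} {X} {Y} exp 1≤X 1≤Y with Σᵛ (2 + k) X ≤? m | Σᵛ (2 + k) Y ≤? m
  ... | yes X≤m | _       = ≤-trans (thin-bound k 1≤X (m+[n∸m]≡n X≤m)) (smallˡ exp _ (m+[n∸m]≡n X≤m))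
  ... | no _    | yes Y≤m = ≤-trans (thin-bound k 1≤Y (m+[n∸m]≡n Y≤m)) (smallʳ exp _ (m+[n∸m]≡n Y≤m))
  ... | no X≰m  | no Y≰m  = ≤-trans (m≤m*n m (suc k)) (large exp (≰⇒≥ X≰m) (≰⇒≥ Y≰m))

  -- A lower bound for the number of edges joining two parts. They correspond to the words of `k`
  -- further letters over the `m + k - 1` remaining symbols: only the empty word for `k = 0`, and
  -- otherwise at least `m` words by the choice of the first letter.
  minEdges : ℕ → ℕ → ℕ
  minEdges zero    m = 1
  minEdges (suc _) m = m

  1≤minEdges : ∀ k {m} → 1 ≤ m → 1 ≤ minEdges k m
  1≤minEdges zero    _   = ≤-refl
  1≤minEdges (suc _) 1≤m = 1≤m

  minEdges≤ΣW : ∀ k {m} {A : Fin n → ℕ} → (∀ j → A j ≤ 1) → 1 ≤ m → suc (Σᶠ A) ≡ m + k →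
                minEdges k m ≤ Σᵛ k (W A)
  minEdges≤ΣW zero    _   _   _ = ≤-refl
  minEdges≤ΣW (suc k) {m} A≤1 1≤m ΣA = ≤-trans (subst (m ≤_) (sym ΣA′) (m≤m+n m k))
    (ΣA≤ΣW k A≤1 (subst (suc k ≤_) (sym ΣA′) (+-monoˡ-≤ k 1≤m)))
    where ΣA′ = suc-injective (trans ΣA (+-suc m k))

  -- There are `m + k + 1` parts, and `m + k` is the least product of two positive numbers with that
  -- sum.
  minEdges-enough : ∀ k {m} → 1 ≤ m → m * suc k ≤ (m + k) * minEdges k m
  minEdges-enough zero    {m} 1≤m = ≤-reflexive (cong (_* 1) (sym (+-identityʳ m)))
  minEdges-enough (suc k) {m} 1≤m =
    subst (_≤ (m + suc k) * m) (*-comm (2 + k) m) (*-monoˡ-≤ m (+-monoˡ-≤ (suc k) 1≤m))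

  module _ {k : ℕ} {A : Fin n → ℕ} {X Y : Vec (Fin n) (2 + k) → ℕ}
           (X+Y≗W : ∀ v → X v + Y v ≡ W A v) {i : Fin n} (Aᵢ≡0 : A i ≡ 0) where

    part-absent : part k X i ≡ 0 × part k Y i ≡ 0
    part-absent =
      ∑-zero (λ v → m+n≡0⇒m≡0 (X (insertSecond i v)) (sum≡0 v)) (allVecs n (suc k)) ,
      ∑-zero (λ v → m+n≡0⇒n≡0 (X (insertSecond i v)) (sum≡0 v)) (allVecs n (suc k))
      where
      sum≡0 : ∀ v → X (insertSecond i v) + Y (insertSecond i v) ≡ 0
      sum≡0 v = trans (X+Y≗W (insertSecond i v))
        (trans (W-insertSecond A i v) (cong (_* W (A ∖ i) v) Aᵢ≡0))

    -- A symbol outside the alphabet gives an empty part, for which the bounds are trivial; so the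
    -- induction hypothesis can range over all of `Fin n`.
    Expanding-absent : ∀ {m} → 1 ≤ m → Expanding k m (X ∘ insertSecond i) (Y ∘ insertSecond i)
    Expanding-absent {m} 1≤m = record
      { smallˡ = λ r _ → subst (λ z → z * (r + k) ≤ e k (X ∘ insertSecond i) (Y ∘ insertSecond i)) (sym (proj₁ part-absent)) z≤n
      ; smallʳ = λ r _ → subst (λ z → z * (r + k) ≤ e k (X ∘ insertSecond i) (Y ∘ insertSecond i)) (sym (proj₂ part-absent)) z≤n
      ; large  = λ m≤0 _ → contradiction (subst (m ≤_) (proj₁ part-absent) m≤0) (<⇒≱ 1≤m)
      }

  -- The induction step: from the parts to the whole graph

  module Step {k m : ℕ} (1≤m : 1 ≤ m) {A : Fin n → ℕ} (A≤1 : ∀ j → A j ≤ 1) (ΣA : Σᶠ A ≡ m + suc k)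
              {X Y : Vec (Fin n) (2 + k) → ℕ} (X+Y≗W : ∀ v → X v + Y v ≡ W A v)
              (IH : ∀ i → Expanding k m (X ∘ insertSecond i) (Y ∘ insertSecond i)) where

    x y t : Fin n → ℕ
    x = part k X
    y = part k Y
    t i = x i ⊓ y i

    |X| : ℕ
    |X| = Σᵛ (2 + k) X

    Σx : |X| ≡ Σᶠ x
    Σx = Σᵛ-insertSecond k X

    Σy : Σᵛ (2 + k) Y ≡ Σᶠ y
    Σy = Σᵛ-insertSecond k Y

    Σin = Σᶠ (inside k X Y)
    cr  = cross k X Y

    e-lower : ∀ {l} → l ≤ Σin + cr → l ≤ e (suc k) X Y
    e-lower {l} = subst (l ≤_) (sym (e-suc k X Y))

    -- If one part contains X, the bound inside it falls short by `|X|`, and each vertex of X has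
    -- its exchange edge leaving X. Otherwise every part holds fewer than `|X|` vertices of X, so
    -- its slack exceeds `r` by at least one, which makes up for the missing symbol without any
    -- cross edges.
    small : ∀ r → |X| + r ≡ m → |X| * (r + suc k) ≤ e (suc k) X Y
    small r X+r≡m with Fin.any? (λ i → x i ≟ |X|)
    ... | yes (i , xᵢ≡X) = e-lower (subst (_≤ Σin + cr) (rearrange |X| r k) (+-mono-≤ insideᵢ escape))
      where
      open ≤-Reasoning
      rearrange : ∀ a r k → a * (r + k) + a ≡ a * (r + suc k)
      rearrange = solve-∀
      insideᵢ : |X| * (r + k) ≤ Σin
      insideᵢ = ≤-trans (subst (λ z → z * (r + k) ≤ inside k X Y i) xᵢ≡X
                          (smallˡ (IH i) r (trans (cong (_+ r) xᵢ≡X) X+r≡m)))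
                        (≤Σᶠ _ i)
      rest : Σᶠ (x ∖ i) ≡ 0
      rest = +-cancelˡ-≡ |X| _ _ (trans (cong (_+ Σᶠ (x ∖ i)) (sym xᵢ≡X))
        (trans (sym (Σᶠ-∖ x i)) (trans (sym Σx) (sym (+-identityʳ |X|)))))
      escape : |X| ≤ cr
      escape = subst₂ _≤_ xᵢ≡X (trans (cong (cr +_) rest) (+-identityʳ cr))
                 (part≤cross A≤1 X Y X+Y≗W i)
    ... | no none = e-lower (m≤n⇒m≤n+o cr (begin
      |X| * (r + suc k)              ≡⟨ cong (_* (r + suc k)) Σx ⟩
      Σᶠ x * (r + suc k)             ≡⟨ ∑-*ʳ (r + suc k) x (allFin n) ⟨
      Σᶠ (λ i → x i * (r + suc k))   ≤⟨ ∑-mono term (allFin n) ⟩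
      Σin                            ∎))
      where
      open ≤-Reasoning
      term : ∀ i → x i * (r + suc k) ≤ inside k X Y i
      term i = begin
        x i * (r + suc k)         ≡⟨ cong (x i *_) (+-suc r k) ⟩
        x i * (suc r + k)         ≤⟨ *-monoʳ-≤ (x i) (+-monoˡ-≤ k (s≤s (m≤n+m r d))) ⟩
        x i * (suc d + r + k)     ≤⟨ smallˡ (IH i) (suc d + r)
                                       (trans (sym (+-assoc (x i) (suc d) r)) (trans (cong (_+ r) xᵢ+d) X+r≡m)) ⟩
        inside k X Y i            ∎
        where
        xᵢ<X : x i < |X|
        xᵢ<X = ≤∧≢⇒< (subst (x i ≤_) (sym Σx) (≤Σᶠ x i)) (λ eq → none (i , eq))
        d = |X| ∸ suc (x i)
        xᵢ+d : x i + suc d ≡ |X|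
        xᵢ+d = trans (+-suc (x i) d) (m+[n∸m]≡n xᵢ<X)

    absent : ∀ {i} → A i ≡ 0 → x i ≡ 0 × y i ≡ 0
    absent = part-absent {X = X} {Y} X+Y≗W

    M : ℕ
    M = minEdges k m

    M≤ : ∀ {i j} → A i ≡ 1 → A j ≡ 1 → i ≢ j → M ≤ Σᵛ k (W ((A ∖ j) ∖ i))
    M≤ {i} {j} Aᵢ≡1 Aⱼ≡1 i≢j = minEdges≤ΣW k
      {A = (A ∖ j) ∖ i} (λ l → ≤-trans (∖≤ (A ∖ j) i l) (≤-trans (∖≤ A j l) (A≤1 l))) 1≤m
      (trans (cong (_+ Σᶠ ((A ∖ j) ∖ i)) (sym (trans (∖-other A i≢j) Aᵢ≡1)))
        (trans (sym (Σᶠ-∖ (A ∖ j) i)) (Σᶠ-remove {A = A} {i = j} Aⱼ≡1 (trans ΣA (+-suc m k)))))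

    private
      one : ∀ {i} → A i ≢ 0 → A i ≡ 1
      one {i} Aᵢ≢0 with ≤1-cases (A≤1 i)
      ... | inj₁ eq = contradiction eq Aᵢ≢0
      ... | inj₂ eq = eq

    -- Part i is mixed and every other part is pure: the pure parts of different
    -- kinds are joined by enough edges.
    pure-cross : ∀ {i} → 1 ≤ k → m ≤ x i → m ≤ y i →
                 (∀ j → j ≢ i → x j ≡ 0 ⊎ y j ≡ 0) → m ≤ cr
    pure-cross {i} 1≤k m≤xᵢ m≤yᵢ pure
      with Fin.any? (λ j → ¬? (j Fin.≟ i) ×-dec 1 ≤? x j) | Fin.any? (λ j → ¬? (j Fin.≟ i) ×-dec 1 ≤? y j)
    -- X lies wholly in part `i`, so each of its vertices leaves X through its exchange edge.
    ... | no none | _ = ≤-trans m≤xᵢ (subst (x i ≤_)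
      (trans (cong (cr +_) (∑-zero zeroˣ (allFin n))) (+-identityʳ cr)) (part≤cross A≤1 X Y X+Y≗W i))
      where
      zeroˣ : ∀ j → (x ∖ i) j ≡ 0
      zeroˣ j with j Fin.≟ i
      ... | yes _  = refl
      ... | no j≢i = n<1⇒n≡0 (≰⇒> (λ 1≤x → none (j , j≢i , 1≤x)))
    ... | yes _ | no none = ≤-trans m≤yᵢ (subst (y i ≤_)
      (trans (cong₂ _+_ (cross-comm k Y X) (∑-zero zeroʸ (allFin n))) (+-identityʳ cr))
      (part≤cross A≤1 Y X (λ v → trans (+-comm (Y v) (X v)) (X+Y≗W v)) i))
      where
      zeroʸ : ∀ j → (y ∖ i) j ≡ 0
      zeroʸ j with j Fin.≟ i
      ... | yes _  = refl
      ... | no j≢i = n<1⇒n≡0 (≰⇒> (λ 1≤y → none (j , j≢i , 1≤y)))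
    ... | yes (j , j≢i , 1≤xⱼ) | yes (l , l≢i , 1≤yₗ) = begin
      -- Besides part `i` there are `m + k > m` parts, and both kinds occur among them.
      m                   ≤⟨ s≤s⁻¹ (≤-trans m<α+β (a+b≤1+ab 1≤Σα 1≤Σβ)) ⟩
      Σᶠ α * Σᶠ β         ≡⟨ *-identityʳ _ ⟨
      Σᶠ α * Σᶠ β * 1     ≤⟨ *-monoʳ-≤ (Σᶠ α * Σᶠ β) (1≤minEdges k 1≤m) ⟩
      Σᶠ α * Σᶠ β * M     ≤⟨ pairs≤cross A≤1 X Y X+Y≗W (λ p → ≤-trans (≤-reflexive (α+β p)) (∖≤ A i p)) M≤ ⟩
      cr + (Σᶠ (λ p → α p * y p) + Σᶠ (λ p → β p * x p))
                          ≡⟨ cong (cr +_) (cong₂ _+_ (∑-zero αy (allFin n)) (∑-zero βx (allFin n))) ⟩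
      cr + 0              ≡⟨ +-identityʳ cr ⟩
      cr                  ∎
      where
      open ≤-Reasoning
      -- Apart from `i`, `α` marks the parts that meet X and `β` the present parts that do not. By
      -- purity both error terms of `pairs≤cross` vanish.
      α β : Fin n → ℕ
      α = (λ p → A p ⊓ x p) ∖ i
      β = (λ p → A p ∸ x p) ∖ i
      α+β : ∀ p → α p + β p ≡ (A ∖ i) p
      α+β p with p Fin.≟ i
      ... | yes _ = refl
      ... | no _  = trans (cong (_+ (A p ∸ x p)) (⊓-comm (A p) (x p))) (m⊓n+n∸m≡n (x p) (A p))
      αy : ∀ p → α p * y p ≡ 0
      αy p with p Fin.≟ i
      ... | yes _ = refl
      ... | no p≢i with pure p p≢i
      ... | inj₁ xₚ≡0 rewrite xₚ≡0 | ⊓-zeroʳ (A p) = refl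
      ... | inj₂ yₚ≡0 rewrite yₚ≡0 = *-zeroʳ (A p ⊓ x p)
      βx : ∀ p → β p * x p ≡ 0
      βx p with p Fin.≟ i
      ... | yes _ = refl
      ... | no p≢i with x p
      ... | zero  = *-zeroʳ (A p)
      ... | suc z = cong (_* suc z) (m≤n⇒m∸n≡0 (≤-trans (A≤1 p) (s≤s z≤n)))
      1≤Σα : 1 ≤ Σᶠ α
      1≤Σα = ≤-trans (subst (1 ≤_) (sym (trans (∖-other _ j≢i) (cong (_⊓ x j) Aⱼ≡1))) (⊓-glb ≤-refl 1≤xⱼ)) (≤Σᶠ α j)
        where
        Aⱼ≡1 : A j ≡ 1
        Aⱼ≡1 = one (λ eq → <⇒≢ 1≤xⱼ (sym (proj₁ (absent eq))))
      1≤Σβ : 1 ≤ Σᶠ β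
      1≤Σβ = ≤-trans (≤-reflexive (sym (trans (∖-other _ l≢i) (cong₂ _∸_ Aₗ≡1 xₗ≡0)))) (≤Σᶠ β l)
        where
        Aₗ≡1 : A l ≡ 1
        Aₗ≡1 = one (λ eq → <⇒≢ 1≤yₗ (sym (proj₂ (absent eq))))
        xₗ≡0 : x l ≡ 0
        xₗ≡0 with pure l l≢i
        ... | inj₁ eq = eq
        ... | inj₂ eq = contradiction (sym eq) (<⇒≢ 1≤yₗ)
      Aᵢ≡1 : A i ≡ 1
      Aᵢ≡1 = one (λ eq → <⇒≢ (≤-trans 1≤m m≤xᵢ) (sym (proj₁ (absent eq))))
      m<α+β : suc m ≤ Σᶠ α + Σᶠ β
      m<α+β = begin
        suc m               ≡⟨ +-comm 1 m ⟩
        m + 1               ≤⟨ +-monoʳ-≤ m 1≤k ⟩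
        m + k               ≡⟨ Σᶠ-remove {A = A} {i = i} Aᵢ≡1 (trans ΣA (+-suc m k)) ⟨
        Σᶠ (A ∖ i)          ≡⟨ ∑-cong α+β (allFin n) ⟨
        Σᶠ (λ p → α p + β p) ≡⟨ ∑-+ α β (allFin n) ⟩
        Σᶠ α + Σᶠ β         ∎

    -- Part `i` supplies `m * k` edges by the induction hypothesis. The missing `m` come from a
    -- second mixed part if there is one, and otherwise from the cross edges.
    mixed-part : ∀ {i} → m ≤ x i → m ≤ y i → m * suc k ≤ e (suc k) X Y
    mixed-part {i} m≤xᵢ m≤yᵢ = go k refl
      where
      go : ∀ k′ → k ≡ k′ → m * suc k ≤ e (suc k) X Y
      -- Here the induction hypothesis gives only 0 edges; the product formula for a clique replaces
      -- it.
      go zero refl = e-lower (m≤n⇒m≤n+o cr (begin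
        m * 1                  ≤⟨ *-mono-≤ m≤xᵢ (≤-trans 1≤m m≤yᵢ) ⟩
        x i * y i              ≡⟨ e-zero (X ∘ insertSecond i) (Y ∘ insertSecond i) ⟨
        inside k X Y i         ≤⟨ ≤Σᶠ (inside k X Y) i ⟩
        Σin                    ∎))
        where open ≤-Reasoning
      go (suc k′) refl with Fin.any? (λ j → ¬? (j Fin.≟ i) ×-dec (1 ≤? x j ×-dec 1 ≤? y j))
      ... | yes (j , j≢i , 1≤xⱼ , 1≤yⱼ) = e-lower (m≤n⇒m≤n+o cr (begin
        m * suc k                         ≡⟨ trans (*-suc m k) (+-comm m (m * k)) ⟩
        m * k + m                         ≤⟨ +-mono-≤ (large (IH i) m≤xᵢ m≤yᵢ) (mixed (IH j) 1≤xⱼ 1≤yⱼ) ⟩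
        inside k X Y i + inside k X Y j   ≤⟨ ≤Σᶠ₂ (inside k X Y) j≢i ⟩
        Σin                               ∎))
        where open ≤-Reasoning
      ... | no none = e-lower (begin
        m * suc k        ≡⟨ trans (*-suc m k) (+-comm m (m * k)) ⟩
        m * k + m        ≤⟨ +-mono-≤ (≤-trans (large (IH i) m≤xᵢ m≤yᵢ) (≤Σᶠ _ i))
                                     (pure-cross (s≤s z≤n) m≤xᵢ m≤yᵢ pure) ⟩
        Σin + cr         ∎)
        where
        open ≤-Reasoning
        pure : ∀ j → j ≢ i → x j ≡ 0 ⊎ y j ≡ 0
        pure j j≢i with 1 ≤? x j | 1 ≤? y j
        ... | no x≱1 | _      = inj₁ (n<1⇒n≡0 (≰⇒> x≱1))
        ... | yes _  | no y≱1 = inj₂ (n<1⇒n≡0 (≰⇒> y≱1))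
        ... | yes p  | yes q  = contradiction (j , j≢i , p , q) none

    -- A minority has fewer than `m` vertices, so its slack `r` is at least 1 and the factor `r + k`
    -- at least `suc k`.
    minority≤inside : ∀ i → ¬ (m ≤ x i × m ≤ y i) → t i * suc k ≤ inside k X Y i
    minority≤inside i not with ≤-total (x i) (y i)
    ... | inj₁ x≤y rewrite m≤n⇒m⊓n≡m x≤y =
      ≤-trans (*-monoʳ-≤ (x i) (s≤s (m≤n+m k _)))
              (smallˡ (IH i) (suc (m ∸ suc (x i))) (trans (+-suc (x i) _) (m+[n∸m]≡n x<m)))
      where
      x<m : x i < m
      x<m = ≰⇒> (λ m≤x → not (m≤x , ≤-trans m≤x x≤y))
    ... | inj₂ y≤x rewrite m≥n⇒m⊓n≡n y≤x =
      ≤-trans (*-monoʳ-≤ (y i) (s≤s (m≤n+m k _)))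
              (smallʳ (IH i) (suc (m ∸ suc (y i))) (trans (+-suc (y i) _) (m+[n∸m]≡n y<m)))
      where
      y<m : y i < m
      y<m = ≰⇒> (λ m≤y → not (≤-trans m≤y y≤x , m≤y))

    α β : Fin n → ℕ
    α i with y i ≤? x i
    ... | yes _ = A i
    ... | no  _ = 0
    β i with y i ≤? x i
    ... | yes _ = 0
    ... | no  _ = A i

    α+β : ∀ i → α i + β i ≡ A i
    α+β i with y i ≤? x i
    ... | yes _ = +-identityʳ (A i)
    ... | no  _ = refl

    -- With parts sorted by majority, the error terms of `pairs≤cross` count only minorities.
    αy+βx≤t : ∀ i → α i * y i + β i * x i ≤ t i
    αy+βx≤t i with y i ≤? x i
    ... | yes y≤x rewrite m≥n⇒m⊓n≡n y≤x = begin
      A i * y i + 0   ≡⟨ +-identityʳ _ ⟩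
      A i * y i       ≤⟨ *-monoˡ-≤ (y i) (A≤1 i) ⟩
      1 * y i         ≡⟨ *-identityˡ (y i) ⟩
      y i             ∎
      where open ≤-Reasoning
    ... | no y≰x rewrite m≤n⇒m⊓n≡m (≰⇒≥ y≰x) =
      ≤-trans (*-monoˡ-≤ (x i) (A≤1 i)) (≤-reflexive (*-identityˡ (x i)))

    α≡0⇒x≤t : ∀ i → α i ≡ 0 → x i ≤ t i
    α≡0⇒x≤t i αᵢ≡0 with y i ≤? x i
    ... | yes _  = subst (_≤ t i) (sym (proj₁ (absent αᵢ≡0))) z≤n
    ... | no y≰x = ≤-reflexive (sym (m≤n⇒m⊓n≡m (≰⇒≥ y≰x)))

    β≡0⇒y≤t : ∀ i → β i ≡ 0 → y i ≤ t i
    β≡0⇒y≤t i βᵢ≡0 with y i ≤? x i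
    ... | yes y≤x = ≤-reflexive (sym (m≥n⇒m⊓n≡n y≤x))
    ... | no _    = subst (_≤ t i) (sym (proj₂ (absent βᵢ≡0))) z≤n

    1≤Σ : ∀ {f : Fin n → ℕ} → ¬ (∀ i → f i ≡ 0) → 1 ≤ Σᶠ f
    1≤Σ {f} f≢0 = n≢0⇒n>0 (λ Σf≡0 → f≢0 (λ i → n≤0⇒n≡0 (subst (f i ≤_) Σf≡0 (≤Σᶠ f i))))

    -- Every part has a minority, of size t i < m. If the minorities are large in
    -- total then so is the inside term; otherwise X holds the majority in some
    -- parts and Y in others.
    minorities : (∀ i → ¬ (m ≤ x i × m ≤ y i)) → m ≤ |X| → m ≤ Σᵛ (2 + k) Y →
                 m * suc k ≤ e (suc k) X Y
    minorities none m≤X m≤Y = conclude (m ≤? Σᶠ t)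
      where
      open ≤-Reasoning
      Σt≤Σin : Σᶠ t * suc k ≤ Σin
      Σt≤Σin = subst (_≤ Σin) (∑-*ʳ (suc k) t (allFin n))
        (∑-mono (λ i → minority≤inside i (none i)) (allFin n))
      conclude : Dec (m ≤ Σᶠ t) → m * suc k ≤ e (suc k) X Y
      conclude (yes m≤Σt) = e-lower (m≤n⇒m≤n+o cr (≤-trans (*-monoˡ-≤ (suc k) m≤Σt) Σt≤Σin))
      conclude (no m≰Σt)  = e-lower (begin
        m * suc k                 ≤⟨ minEdges-enough k 1≤m ⟩
        (m + k) * M               ≤⟨ *-monoˡ-≤ M (s≤s⁻¹ (subst (_≤ suc (Σᶠ α * Σᶠ β)) Σα+Σβ (a+b≤1+ab 1≤Σα 1≤Σβ))) ⟩
        Σᶠ α * Σᶠ β * M           ≤⟨ pairs≤cross A≤1 X Y X+Y≗W (λ i → ≤-reflexive (α+β i)) M≤ ⟩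
        cr + (Σᶠ (λ i → α i * y i) + Σᶠ (λ i → β i * x i))
                                  ≡⟨ cong (cr +_) (∑-+ (λ i → α i * y i) (λ i → β i * x i) (allFin n)) ⟨
        cr + Σᶠ (λ i → α i * y i + β i * x i)
                                  ≤⟨ +-monoʳ-≤ cr (∑-mono αy+βx≤t (allFin n)) ⟩
        -- The edges inside the parts pay for the error term.
        cr + Σᶠ t                 ≤⟨ +-monoʳ-≤ cr (≤-trans (m≤m*n (Σᶠ t) (suc k)) Σt≤Σin) ⟩
        cr + Σin                  ≡⟨ +-comm cr Σin ⟩
        Σin + cr                  ∎)
        where
        Σα+Σβ : Σᶠ α + Σᶠ β ≡ suc (m + k)
        Σα+Σβ = trans (sym (∑-+ α β (allFin n))) (trans (∑-cong α+β (allFin n)) (trans ΣA (+-suc m k)))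
        1≤Σα : 1 ≤ Σᶠ α
        -- If X had the majority in no part, the minorities would contain all of X, at least `m`
        -- vertices.
        1≤Σα = 1≤Σ (λ α≗0 → m≰Σt (≤-trans m≤X
          (subst (_≤ Σᶠ t) (sym Σx) (∑-mono (λ i → α≡0⇒x≤t i (α≗0 i)) (allFin n)))))
        1≤Σβ : 1 ≤ Σᶠ β
        1≤Σβ = 1≤Σ (λ β≗0 → m≰Σt (≤-trans m≤Y
          (subst (_≤ Σᶠ t) (sym Σy) (∑-mono (λ i → β≡0⇒y≤t i (β≗0 i)) (allFin n)))))

    large-step : m ≤ |X| → m ≤ Σᵛ (2 + k) Y → m * suc k ≤ e (suc k) X Y
    large-step m≤X m≤Y with Fin.any? (λ i → m ≤? x i ×-dec m ≤? y i)
    ... | yes (_ , m≤xᵢ , m≤yᵢ) = mixed-part m≤xᵢ m≤yᵢ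
    ... | no none               = minorities (λ i p → none (i , p)) m≤X m≤Y

  Expanding-sym : ∀ {k m X Y} → Expanding k m X Y → Expanding k m Y X
  Expanding-sym {k} {m} {X} {Y} exp = record
    { smallˡ = λ r eq → subst (_ ≤_) (e-comm k X Y) (smallʳ exp r eq)
    ; smallʳ = λ r eq → subst (_ ≤_) (e-comm k X Y) (smallˡ exp r eq)
    ; large  = λ m≤Y m≤X → subst (_ ≤_) (e-comm k X Y) (large exp m≤X m≤Y)
    }

  -- The alphabet must vary for the induction: part `i` consists of words over `A ∖ i`, which has
  -- one symbol less, while the words are one letter shorter and `m` is unchanged.
  expanding : ∀ k {m} → 1 ≤ m → ∀ {A : Fin n → ℕ} → (∀ j → A j ≤ 1) → Σᶠ A ≡ m + k →
              ∀ {X Y} → (∀ v → X v + Y v ≡ W A v) → Expanding k m X Y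
  expanding zero {m} 1≤m {A} A≤1 ΣA {X} {Y} X+Y≗W = record
    -- One-letter words form a clique on `m` vertices, and `r` is the size of the other side.
    { smallˡ = λ r eq → ≤-reflexive (trans
        (cong (Σᵛ 1 X *_) (trans (+-identityʳ r) (+-cancelˡ-≡ (Σᵛ 1 X) _ _ (trans eq (sym X+Y)))))
        (sym (e-zero X Y)))
    ; smallʳ = λ r eq → ≤-reflexive (trans (*-comm (Σᵛ 1 Y) (r + 0)) (trans
        (cong (_* Σᵛ 1 Y) (trans (+-identityʳ r) (+-cancelʳ-≡ (Σᵛ 1 Y) _ _ (trans (+-comm r _) (trans eq (sym X+Y))))))
        (sym (e-zero X Y))))
    ; large  = λ _ _ → subst (_≤ e 0 X Y) (sym (*-zeroʳ m)) z≤n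
    }
    where
    X+Y : Σᵛ 1 X + Σᵛ 1 Y ≡ m
    X+Y = trans (sym (∑-+ X Y (allVecs n 1))) (trans (∑-cong X+Y≗W (allVecs n 1))
      (trans (ΣW-∷ A 0) (trans (∑-cong (λ x → *-identityʳ (A x)) (allFin n)) (trans ΣA (+-identityʳ m)))))
  expanding (suc k) {m} 1≤m {A} A≤1 ΣA {X} {Y} X+Y≗W = record
    { smallˡ = Step.small 1≤m A≤1 ΣA {X} {Y} X+Y≗W IH
    ; smallʳ = λ r eq → subst (_ ≤_) (e-comm (suc k) Y X)
        (Step.small 1≤m A≤1 ΣA {Y} {X} (λ v → trans (+-comm (Y v) (X v)) (X+Y≗W v)) (Expanding-sym ∘ IH) r eq)
    ; large  = Step.large-step 1≤m A≤1 ΣA {X} {Y} X+Y≗W IH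
    }
    where
    IH : ∀ i → Expanding k m (X ∘ insertSecond i) (Y ∘ insertSecond i)
    IH i with ≤1-cases (A≤1 i)
    ... | inj₂ Aᵢ≡1 = expanding k 1≤m (λ j → ≤-trans (∖≤ A i j) (A≤1 j))
      (Σᶠ-remove {A = A} {i = i} Aᵢ≡1 (trans ΣA (+-suc m k)))
      (λ v → trans (X+Y≗W (insertSecond i v)) (trans (W-insertSecond A i v)
        (trans (cong (_* W (A ∖ i) v) Aᵢ≡1) (+-identityʳ _))))
    ... | inj₁ Aᵢ≡0 = Expanding-absent {X = X} {Y} X+Y≗W Aᵢ≡0 1≤m

-- Pigeonhole principle

module _ {A B : Set} where

  Any-─ : ∀ {P Q : B → Set} {ys} (p : Any P ys) → Any Q ys →
          (∀ {y} → P y → Q y → ¬ Q y) → Any Q (ys ─ p)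
  Any-─ (here py) (here qy) ¬q = contradiction qy (¬q py qy)
  Any-─ (here py) (there q) ¬q = q
  Any-─ (there p) (here qy) ¬q = here qy
  Any-─ (there p) (there q) ¬q = there (Any-─ p q ¬q)

  -- The relation `R` need not be inequality, so that lists of pairs that may repeat a loop are
  -- covered as well.
  pigeonhole : ∀ {R : Rel A 0ℓ} (Q : A → B → Set) →
               (∀ {x x′ y} → Q x y → Q x′ y → ¬ R x x′) →
               ∀ {xs ys} → AllPairs R xs → All (λ x → Any (Q x) ys) xs → length xs ≤ length ys
  pigeonhole Q clash [] [] = z≤n
  pigeonhole Q clash {x ∷ xs} {ys} (Rx ∷ Rxs) (q ∷ qs) =
    subst (suc (length xs) ≤_) (sym (List.length-removeAt′ ys (Any.index q)))
      (s≤s (pigeonhole Q clash Rxs (All.zipWith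
        (λ (Rxx′ , q′) → Any-─ q q′ (λ qy q′y → contradiction Rxx′ (clash qy q′y))) (Rx , qs))))

-- The list of edges

module _ {n : ℕ} where

  insertSecond-injective : ∀ {k i} {u v : Vec (Fin n) (suc k)} →
                           insertSecond i u ≡ insertSecond i v → u ≡ v
  insertSecond-injective {u = _ ∷ _} {_ ∷ _} refl = refl

  -- The pairs are distinct except for loops (v , v), which arise when the
  -- first two entries of v agree.
  DistinctUnlessLoop : ∀ {k} → Rel (Vec (Fin n) (suc k) × Vec (Fin n) (suc k)) 0ℓ
  DistinctUnlessLoop e f = e ≡ f → proj₁ e ≡ proj₂ e

  distinct-edges : ∀ k → AllPairs DistinctUnlessLoop (edges {n} k)
  distinct-edges zero = AllPairs.map (λ e≢f e≡f → contradiction e≡f e≢f)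
    (cartesianProductWith⁺ _ (λ { refl → refl , refl }) (allFin⁺ n) (allFin⁺ n))
  distinct-edges (suc k) = AllPairs.++⁺
    (AllPairs.concat⁺
      (All.map⁺ (All.tabulate λ {i} _ → AllPairs.map⁺ (AllPairs.map (lift i) (distinct-edges k))))
      (AllPairs.map⁺ {f = λ i → map (insertBoth i) (edges k)} (AllPairs.map (λ i≢j → All.map⁺ (All.tabulate λ _ → All.map⁺ (All.tabulate λ _ eq →
        contradiction eq (different i≢j)))) (allFin⁺ n))))
    (AllPairs.map⁺ (AllPairs.map (λ u≢v eq → contradiction (cong proj₁ eq) u≢v) (allVecs-unique n (2 + k))))
    (All.concat⁺ {xss = map (λ i → map (insertBoth i) (edges k)) (allFin n)} (All.map⁺ (All.tabulate λ {i} _ → All.map⁺ (All.tabulate λ {(u , v)} _ →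
      All.map⁺ (All.tabulate λ {w} _ eq → loop i u v w (cong proj₁ eq) (cong proj₂ eq))))))
    where
    lift : ∀ i {e f} → DistinctUnlessLoop e f →
           DistinctUnlessLoop (insertBoth i e) (insertBoth i f)
    lift i d eq = cong (insertSecond i)
      (d (cong₂ _,_ (insertSecond-injective (cong proj₁ eq)) (insertSecond-injective (cong proj₂ eq))))
    different : ∀ {i j : Fin n} → i ≢ j → ∀ {k} {e f : Vec (Fin n) (suc k) × Vec (Fin n) (suc k)} →
                insertBoth i e ≢ insertBoth j f
    different i≢j {e = _ ∷ _ , _ ∷ _} {_ ∷ _ , _ ∷ _} refl = i≢j refl
    -- A pair inside part `i` can be an exchange pair only if the word begins with `i ∷ i`, and then
    -- the pair is a loop.
    loop : ∀ i {k} (u v : Vec (Fin n) (suc k)) (w : Vec (Fin n) (2 + k)) →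
           insertSecond i u ≡ w → insertSecond i v ≡ exchange w → insertSecond i u ≡ insertSecond i v
    loop i (x ∷ xs) (y ∷ ys) (.x ∷ .i ∷ .xs) refl refl = refl

  edges-adjacent : ∀ k {u v} → (u , v) ∈ edges {n} k → Vec.Unique u → Vec.Unique v → u ≢ v →
                   StarAdjacent u v
  edges-adjacent zero uv∈ u! v! u≢v
    with x , y , _ , _ , refl ← ∈-cartesianProductWith⁻ _ (allFin n) (allFin n) uv∈ =
    replace y (λ { (VecAny.here refl) → u≢v refl }) refl
  edges-adjacent (suc k) uv∈ u! v! u≢v with ∈-++⁻ (concatMap _ (allFin n)) uv∈
  ... | inj₂ uv∈cross with w , _ , refl ← ∈-map⁻ _ uv∈cross = swap Fin.zero refl
  ... | inj₁ uv∈inside with i , uv∈ᵢ ← Any.satisfied (∈-concatMap⁻ _ {allFin n} uv∈inside)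
    with (u , v) , uv∈ₖ , refl ← ∈-map⁻ _ uv∈ᵢ =
    insert (edges-adjacent k uv∈ₖ (shrink u! ) (shrink v!) (u≢v ∘ cong (insertSecond i))) v!
    where
    shrink : ∀ {k i} {u : Vec (Fin n) (suc k)} → Vec.Unique (insertSecond i u) → Vec.Unique u
    shrink {u = _ ∷ _} ((_ VecAll.∷ x∉) VecAllPairs.∷ (_ VecAllPairs.∷ xs!)) = x∉ VecAllPairs.∷ xs!
    insert : ∀ {k i} {u v : Vec (Fin n) (suc k)} → StarAdjacent u v → Vec.Unique (insertSecond i v) →
             StarAdjacent (insertSecond i u) (insertSecond i v)
    insert {u = _ ∷ _} (swap j refl) _ = swap (Fin.suc j) refl
    insert {u = _ ∷ _} {v = _ ∷ _} (replace y y∉ refl) ((y≢i VecAll.∷ _) VecAllPairs.∷ _) = replace y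
      (λ { (VecAny.here eq) → y∉ (VecAny.here eq)
         ; (VecAny.there (VecAny.here eq)) → y≢i eq
         ; (VecAny.there (VecAny.there y∈)) → y∉ (VecAny.there y∈) }) refl

  -- Two listed pairs matching the same unordered pair of `B` are equal or reversed. Equal entries
  -- of the list would form a loop, and reversed ones would share an end; either way some vertex
  -- would lie in both X and Y.
  e≤length : ∀ k (X Y : Vec (Fin n) (suc k) → ℕ) → (∀ v → X v + Y v ≤ 1) →
             ∀ B → (∀ {u v} → (u , v) ∈ edges k → 1 ≤ X u → 1 ≤ Y v → Any ((u , v) ≈ₑ_) B) →
             e k X Y ≤ length B
  e≤length k X Y X+Y≤1 B covers = ≤-trans
    (∑≤length-filter (λ (u , v) → *-mono-≤ (m+n≤o⇒m≤o (X u) (X+Y≤1 u)) (m+n≤o⇒n≤o (X v) (X+Y≤1 v))) (edges k))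
    (pigeonhole Q clash (AllPairs.filter⁺ F? (distinct-edges k)) (All.tabulate cover))
    where
    F? = λ ((u , v) : _ × _) → 1 ≤? X u * Y v
    Q : (Vec (Fin n) (suc k) × Vec (Fin n) (suc k)) → (Vec (Fin n) (suc k) × Vec (Fin n) (suc k)) → Set
    Q (u , v) b = (1 ≤ X u × 1 ≤ Y v) × (u , v) ≈ₑ b

    disjoint : ∀ {v} → 1 ≤ X v → 1 ≤ Y v → {C : Set} → C
    disjoint {v} 1≤X 1≤Y = contradiction (X+Y≤1 v) (<⇒≱ (+-mono-≤ 1≤X 1≤Y))

    clash : ∀ {e f b} → Q e b → Q f b → ¬ DistinctUnlessLoop e f
    clash ((Xu , Yv) , inj₁ (refl , refl)) ((Xu′ , Yv′) , inj₁ (refl , refl)) d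
      with refl ← d refl = disjoint Xu Yv
    clash ((Xu , Yv) , inj₁ (refl , refl)) ((Xu′ , Yv′) , inj₂ (refl , refl)) d = disjoint Xu Yv′
    clash ((Xu , Yv) , inj₂ (refl , refl)) ((Xu′ , Yv′) , inj₁ (refl , refl)) d = disjoint Xu Yv′
    clash ((Xu , Yv) , inj₂ (refl , refl)) ((Xu′ , Yv′) , inj₂ (refl , refl)) d
      with refl ← d refl = disjoint Xu Yv

    cover : ∀ {uv} → uv ∈ filter F? (edges k) → Any (Q uv) B
    cover {u , v} uv∈ with ∈-filter⁻ F? {xs = edges k} uv∈
    ... | uv∈edges , 1≤XY with X u in Xu | Y v in Yv
    ... | zero  | _     = contradiction 1≤XY λ ()
    ... | suc a | zero  = contradiction (subst (1 ≤_) (*-zeroʳ a) 1≤XY) λ ()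
    ... | suc a | suc b = Any.map ((s≤s z≤n , s≤s z≤n) ,_)
      (covers uv∈edges (subst (1 ≤_) (sym Xu) (s≤s z≤n)) (subst (1 ≤_) (sym Yv) (s≤s z≤n)))

-- Validity is distinctness

  W-valid : ∀ {A k} {v : Vec (Fin n) k} → VecAll.All (λ x → A x ≡ 1) v → Vec.Unique v → W A v ≡ 1
  W-valid VecAll.[] VecAllPairs.[] = refl
  W-valid {A} (Ax VecAll.∷ Axs) (x∉xs VecAllPairs.∷ xs!) = cong₂ _*_ Ax
    (W-valid (VecAll.map (λ (x≢y , Ay) → trans (∖-other A (≢-sym x≢y)) Ay) (VecAll.zip (x∉xs , Axs))) xs!)

  W-invalid : ∀ {A k} {v : Vec (Fin n) k} → W A v ≢ 0 → VecAll.All (λ x → A x ≢ 0) v × Vec.Unique v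
  W-invalid {v = []} _ = VecAll.[] , VecAllPairs.[]
  W-invalid {A} {v = x ∷ xs} W≢0 with W-invalid {A ∖ x} {v = xs} (λ eq → W≢0 (trans (cong (A x *_) eq) (*-zeroʳ (A x))))
  ... | A∖x , xs! =
    (λ eq → W≢0 (cong (_* W (A ∖ x) xs) eq)) VecAll.∷
    VecAll.map (λ ne Ay≡0 → ne (n≤0⇒n≡0 (≤-trans (∖≤ A x _) (≤-reflexive Ay≡0)))) A∖x
    , VecAll.map (λ ne x≡y → ne (subst (λ z → (A ∖ x) z ≡ 0) x≡y (∖-self A x))) A∖x VecAllPairs.∷ xs!

  weight : ∀ {k} → (P n k → Bool) → Vec (Fin n) k → ℕ
  weight χ v with unique? v
  ... | yes v! = if χ (v , [ v! ]) then 1 else 0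
  ... | no _   = 0

  weight-complement : ∀ {k} (χ : P n k → Bool) v → weight χ v + weight (not ∘ χ) v ≡ W (λ _ → 1) v
  weight-complement χ v with unique? v
  ... | yes v! with χ (v , [ v! ])
  ...   | true  = sym (W-valid (VecAll.universal (λ _ → refl) v) v!)
  ...   | false = sym (W-valid (VecAll.universal (λ _ → refl) v) v!)
  weight-complement χ v | no ¬v! with W (λ _ → 1) v ≟ 0
  ... | yes eq = sym eq
  ... | no ne  = contradiction (proj₂ (W-invalid ne)) ¬v!

  weight-vertex : ∀ {k} (χ : P n k → Bool) p → χ p ≡ true → 1 ≤ weight χ (value p)
  weight-vertex χ (v , [ v! ]) χp with unique? v
  ... | yes _  rewrite χp = ≤-refl
  ... | no ¬v! = contradiction (unique-value (v , [ v! ])) ¬v!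

  weight-vertex⁻ : ∀ {k} (χ : P n k → Bool) v → 1 ≤ weight χ v → ∃[ p ] value p ≡ v × χ p ≡ true
  weight-vertex⁻ χ v 1≤w with unique? v
  ... | yes v! with χ (v , [ v! ]) in χv
  ...   | true = (v , [ v! ]) , refl , χv

  length≤weight : ∀ {k} (χ : P n k → Bool) {ps} → Unique ps → All (λ p → χ p ≡ true) ps →
                  length ps ≤ Σᵛ k (weight χ)
  length≤weight {k} χ ps! χps = ≤-trans
    (pigeonhole (λ p v → value p ≡ v) (λ { refl eq p≢p′ → p≢p′ (value-injective (sym eq)) }) ps!
      (All.map (λ {p} χp → ∈-filter⁺ (λ v → 1 ≤? weight χ v) (allVecs-complete (value p)) (weight-vertex χ p χp)) χps))
    (length-filter≤∑ (weight χ) (allVecs n k))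

-- Components

¬¬-All : ∀ {A : Set} {P : A → Set} xs → (∀ x → ¬ ¬ P x) → ¬ ¬ All P xs
¬¬-All []       _   ¬all = ¬all []
¬¬-All (x ∷ xs) ¬¬p ¬all = ¬¬p x (λ px → ¬¬-All xs ¬¬p (λ pxs → ¬all (px ∷ pxs)))

module _ (G : Graph) where
  open Graph G

  -- As `C` is decidable, it may be proved under a double negation. There reachability may be
  -- assumed decided for the finitely many pairs of vertices, without a search procedure.
  disconnected-elim : ∀ {C : Set} → Dec C → Disconnected G →
    (∀ u v → (∀ w → Dec (Star _~_ u w)) → ¬ Star _~_ u v → C) → C
  disconnected-elim C? disconnected separated = decidable-stable C? λ ¬c →
    ¬¬-All vertices (λ u → ¬¬-All {P = λ w → Dec (Star _~_ u w)} vertices (λ _ → ¬¬-excluded-middle)) λ reach? →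
    disconnected λ u v →
      let dec = λ w → All.lookup (All.lookup reach? (complete u)) (complete w) in
      decidable-stable (dec v) (λ ¬uv → ¬c (separated u v dec ¬uv))

  -- The witnesses are `v` and its neighbours. It is applied to both sides of a cut.
  degree<closed-size : ∀ {h} (Q : Vertex → Set) v → h ≤ degree G v → Q v → (∀ {w} → v ~ w → Q w) →
    ∃[ ws ] Unique ws × All Q ws × suc h ≤ length ws
  degree<closed-size Q v h≤deg Qv closed =
    v ∷ neighbours ,
    All.tabulate (λ w∈ v≡w → ~-irrefl v≡w (proj₂ (∈-filter⁻ (v ~?_) {xs = vertices} w∈))) ∷ filter⁺ (v ~?_) unique ,
    Qv ∷ All.tabulate (λ w∈ → closed (proj₂ (∈-filter⁻ (v ~?_) {xs = vertices} w∈))) ,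
    s≤s h≤deg
    where neighbours = filter (v ~?_) vertices

-- The lower bound for an arbitrary cut

Σᶠ-one : ∀ n → Σᶠ {n} (λ _ → 1) ≡ n
Σᶠ-one n = trans (∑-one (allFin n)) (List.length-tabulate {n = n} (λ i → i))
  where
  ∑-one : ∀ {A : Set} (xs : List A) → ∑ xs (λ _ → 1) ≡ length xs
  ∑-one []       = refl
  ∑-one (_ ∷ xs) = cong suc (∑-one xs)

-- X is the set reachable from `u` after the deletion, so every edge from X to its complement
-- belongs to `B`, and the expansion bounds apply to `size B`.
cut-lower-bound : ∀ {n m k h b} → n ≡ m + k → suc h ≤ m →
  (∀ x r → suc h ≤ x → x + r ≡ m → b ≤ x * (r + k)) →
  (B : EdgeSet (S n (suc k))) → IsEdgeCut h (S n (suc k)) B → b ≤ EdgeSet.size B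
cut-lower-bound {n} {m} {k} {h} {b} n≡m+k h<m bound B (disconnected , minDegree) =
  disconnected-elim G′ (b ≤? EdgeSet.size B) disconnected separated
  where
  G′ = S n (suc k) - B
  open Graph G′
  module _ (u v : Vertex) (reach? : ∀ w → Dec (Star _~_ u w)) (¬uv : ¬ Star _~_ u v) where
    χ : Vertex → Bool
    χ w = does (reach? w)
    X Y : Vec (Fin n) (suc k) → ℕ
    X = weight χ
    Y = weight (not ∘ χ)

    reached : ∀ {w} → χ w ≡ true → Star _~_ u w
    reached {w} χw with reach? w
    ... | yes uw = uw

    unreached : ∀ {w} → not (χ w) ≡ true → ¬ Star _~_ u w
    unreached {w} χw with reach? w
    ... | no ¬uw = ¬uw

    h<X : suc h ≤ Σᵛ (suc k) X
    h<X with ws , ws! , reachable , h<ws ← degree<closed-size G′ (Star _~_ u) u (minDegree u) ε (_◅ ε) =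
      ≤-trans h<ws (length≤weight χ ws! (All.map (dec-true (reach? _)) reachable))

    h<Y : suc h ≤ Σᵛ (suc k) Y
    h<Y with ws , ws! , unreachable , h<ws ← degree<closed-size G′ (λ w → ¬ Star _~_ u w) v (minDegree v) ¬uv
               (λ v~w uw → ¬uv (uw ◅◅ (~-sym v~w ◅ ε))) =
      ≤-trans h<ws (length≤weight (not ∘ χ) ws! (All.map (λ ¬uw → cong not (dec-false (reach? _) ¬uw)) unreachable))

    X+Y≤1 : ∀ w → X w + Y w ≤ 1
    X+Y≤1 w = subst (_≤ 1) (sym (weight-complement χ w)) (W≤1 (λ _ → ≤-refl) w)

    covers : ∀ {p q} → (p , q) ∈ edges k → 1 ≤ X p → 1 ≤ Y q →
             Any ((p , q) ≈ₑ_) (map (λ (a , c) → value a , value c) (EdgeSet.edges B))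
    covers {p} {q} pq∈ Xp Yq
      with p′ , refl , χp ← weight-vertex⁻ χ p Xp | q′ , refl , χq ← weight-vertex⁻ (not ∘ χ) q Yq =
      Any.map⁺ (Any.map (λ { (inj₁ (refl , refl)) → inj₁ (refl , refl)
                           ; (inj₂ (refl , refl)) → inj₂ (refl , refl) })
        (decidable-stable cut? λ uncut → unreached χq (reached χp ◅◅ ((adjacent , uncut) ◅ ε))))
      where
      adjacent : StarAdjacent (value p′) (value q′)
      adjacent = edges-adjacent k pq∈ (unique-value p′) (unique-value q′)
        (λ eq → unreached χq (subst (Star _~_ u) (value-injective eq) (reached χp)))
      cut? : Dec (Any ((p′ , q′) ≈ₑ_) (EdgeSet.edges B))
      cut? = Any.any? (λ (a , c) → ((p′ ≟ᴾ a) ×-dec (q′ ≟ᴾ c)) ⊎-dec ((p′ ≟ᴾ c) ×-dec (q′ ≟ᴾ a))) (EdgeSet.edges B)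

    e≤size : e k X Y ≤ EdgeSet.size B
    e≤size = ≤-trans (e≤length k X Y X+Y≤1 _ covers) (≤-reflexive (List.length-map _ (EdgeSet.edges B)))

    exp : Expanding k m X Y
    exp = expanding k (≤-trans (s≤s z≤n) h<m) (λ _ → ≤-refl) (trans (Σᶠ-one n) n≡m+k) (weight-complement χ)

    separated : b ≤ EdgeSet.size B
    separated with Σᵛ (suc k) X ≤? m | Σᵛ (suc k) Y ≤? m
    ... | yes X≤m | _       =
      ≤-trans (≤-trans (bound _ _ h<X (m+[n∸m]≡n X≤m)) (Expanding.smallˡ exp _ (m+[n∸m]≡n X≤m))) e≤size
    ... | no _    | yes Y≤m =
      ≤-trans (≤-trans (bound _ _ h<Y (m+[n∸m]≡n Y≤m)) (Expanding.smallʳ exp _ (m+[n∸m]≡n Y≤m))) e≤size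
    ... | no X≰m  | no Y≰m  =
      -- The bound `m * k` for two large sides is the value of `x * (r + k)` at `x = m`, `r = 0`.
      ≤-trans (≤-trans (bound m 0 h<m (+-identityʳ m)) (Expanding.large exp (≰⇒≥ X≰m) (≰⇒≥ Y≰m))) e≤size

-- Edge boundaries

module Boundary (G : Graph) {K : Graph.Vertex G → Set} (K? : U.Decidable K) where
  open Graph G

  Crossing : Vertex × Vertex → Set
  Crossing (u , v) = K u × ¬ K v × u ~ v

  crossing? : U.Decidable Crossing
  crossing? (u , v) = K? u ×-dec (¬? (K? v) ×-dec (u ~? v))

  crossings : List (Vertex × Vertex)
  crossings = filter crossing? (cartesianProduct vertices vertices)

  crossing : All Crossing crossings
  crossing = All.tabulate (λ e∈ → proj₂ (∈-filter⁻ crossing? {xs = cartesianProduct vertices vertices} e∈))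

  unique-crossings : Unique crossings
  unique-crossings = filter⁺ crossing? (cartesianProduct⁺ unique unique)

  boundary : EdgeSet G
  boundary = record
    { edges    = crossings
    ; areEdges = All.map (λ (_ , _ , u~v) → u~v) crossing
    ; distinct = oriented crossing unique-crossings
    }
    where
    -- Every listed pair leads from `K` to its complement, so no two of them are reverses of each
    -- other.
    oriented : ∀ {es} → All Crossing es → Unique es → AllPairs (λ e f → ¬ e ≈ₑ f) es
    oriented []         []           = []
    oriented (c ∷ cs) (e∉es ∷ es!) = All.zipWith
      (λ { (c′ , e≢f) (inj₁ (refl , refl)) → e≢f refl
         ; ((_ , ¬Kv , _) , e≢f) (inj₂ (refl , refl)) → ¬Kv (proj₁ c) }) (cs , e∉es) ∷ oriented cs es!

  keep : ∀ {u v} → u ~ v → (K u → K v) → (K v → K u) → Graph._~_ (G - boundary) u v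
  keep u~v Ku⇒Kv Kv⇒Ku = u~v , λ uv∈ → All.lookupWith
    (λ { (Ku , ¬Kv , _) (inj₁ (refl , refl)) → ¬Kv (Ku⇒Kv Ku)
       ; (Kv , ¬Ku , _) (inj₂ (refl , refl)) → ¬Ku (Kv⇒Ku Kv) }) crossing uv∈

  stays : ∀ {u v} → Star (Graph._~_ (G - boundary)) u v → K u → K v
  stays ε                       Ku = Ku
  stays {u} (_◅_ {j = w} (u~w , uncut) ws) Ku = stays ws (decidable-stable (K? w) λ ¬Kw →
    uncut (Any.map (λ { refl → inj₁ (refl , refl) })
      (∈-filter⁺ crossing? (∈-cartesianProduct⁺ (complete u) (complete w)) (Ku , ¬Kw , u~w))))

  boundary-disconnects : ∀ {u v} → K u → ¬ K v → Disconnected (G - boundary)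
  boundary-disconnects Ku ¬Kv connected = ¬Kv (stays (connected _ _) Ku)

-- Swaps

swapFirst-unique : ∀ {A : Set} {k} (i : Fin k) {p : Vec A (suc k)} → Vec.Unique p → Vec.Unique (swapFirst i p)
swapFirst-unique Fin.zero {x ∷ y ∷ ys} ((x≢y VecAll.∷ x∉ys) VecAllPairs.∷ (y∉ys VecAllPairs.∷ ys!)) =
  (≢-sym x≢y VecAll.∷ y∉ys) VecAllPairs.∷ (x∉ys VecAllPairs.∷ ys!)
swapFirst-unique (Fin.suc i) {x ∷ y ∷ ys} ((x≢y VecAll.∷ x∉ys) VecAllPairs.∷ (y∉ys VecAllPairs.∷ ys!))
  with swapFirst-unique i {x ∷ ys} (x∉ys VecAllPairs.∷ ys!)
... | z∉ VecAllPairs.∷ zs! =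
  (≢-sym (VecAll.lookup y∉ys (∈-lookup i ys)) VecAll.∷ z∉) VecAllPairs.∷ (updated i (≢-sym x≢y) y∉ys VecAllPairs.∷ zs!)
  where
  updated : ∀ {A : Set} {P : A → Set} {k} {xs : Vec A k} i {x} → P x → VecAll.All P xs → VecAll.All P (xs Vec.[ i ]≔ x)
  updated Fin.zero    px (_ VecAll.∷ pxs) = px VecAll.∷ pxs
  updated (Fin.suc i) px (p VecAll.∷ pxs) = p VecAll.∷ updated i px pxs

swapFirst-injective : ∀ {A : Set} {k} {p : Vec A (suc k)} → Vec.Unique p → ∀ i j →
                      swapFirst i p ≡ swapFirst j p → i ≡ j
swapFirst-injective {p = x ∷ xs} (_ VecAllPairs.∷ xs!) i j eq =
  VecUnique.lookup-injective xs! i j (Vec.∷-injectiveˡ eq)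

-- The swap brings the first entry into the tail, where it did not occur before. Hence swaps always
-- leave the clique.
swapFirst-tail : ∀ {A : Set} {k} {p : Vec A (suc k)} → Vec.Unique p → ∀ i {y} → swapFirst i p ≢ y ∷ Vec.tail p
swapFirst-tail {p = x ∷ xs} p! i {y} eq = head∉tail p! (subst (_∈ᵛ xs)
  (trans (cong (λ ys → Vec.lookup ys i) (sym (Vec.∷-injectiveʳ eq))) (Vec.lookup∘updateAt i xs)) (∈-lookup i xs))

-- Cutting off s vertices with a common tail

module CliqueCut (s r k : ℕ) where

  n = s + r + k
  G = S n (suc k)

  tail : Vec (Fin n) k
  tail = Vec.tabulate ((s + r) ↑ʳ_)

  word : Fin (s + r) → Vec (Fin n) (suc k)
  word j = (j ↑ˡ k) ∷ tail

  ∉tail : ∀ {j} → j ↑ˡ k ∉ᵛ tail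
  ∉tail {j} j∈ with i , eq ← VecAny.tabulate⁻ j∈
    with () ← trans (sym (Fin.splitAt-↑ˡ (s + r) j k)) (trans (cong (splitAt (s + r)) eq) (Fin.splitAt-↑ʳ (s + r) k i))

  word-injective : ∀ {i j} → word i ≡ word j → i ≡ j
  word-injective eq = Fin.↑ˡ-injective k _ _ (Vec.∷-injectiveˡ eq)

  word! : ∀ j → Vec.Unique (word j)
  word! j = All∉ VecAllPairs.∷ VecUnique.tabulate⁺ (λ {i} {j} → Fin.↑ʳ-injective (s + r) i j)
    where
    All∉ : VecAll.All (j ↑ˡ k ≢_) tail
    All∉ = VecAll.lookup⁻ (λ i eq → ∉tail (subst (_∈ᵛ tail) (sym eq) (∈-lookup i tail)))

  vertex : Fin (s + r) → P n (suc k)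
  vertex j = word j , [ word! j ]

  vertex-adjacent : ∀ {i j} → i ≢ j → StarAdjacent (word i) (word j)
  vertex-adjacent {i} {j} i≢j = replace (j ↑ˡ k)
    (λ { (VecAny.here eq) → i≢j (sym (Fin.↑ˡ-injective k _ _ eq)) ; (VecAny.there j∈) → ∉tail j∈ }) refl

  symbol : ∀ x → x ∉ᵛ tail → ∃[ j ] x ≡ j ↑ˡ k
  symbol x x∉ with splitAt (s + r) x in eq
  ... | inj₁ j = j , sym (Fin.splitAt⁻¹-↑ˡ eq)
  ... | inj₂ i = contradiction (subst (_∈ᵛ tail) (Fin.splitAt⁻¹-↑ʳ eq) (∈-tabulate⁺ _ i)) x∉

  K : P n (suc k) → Set
  K v = ∃[ c ] value v ≡ word (c ↑ˡ r)

  K? : U.Decidable K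
  K? v = Fin.any? (λ c → Vec.≡-dec Fin._≟_ (value v) (word (c ↑ˡ r)))

  open Boundary G K?

  side : ∀ j {v : P n (suc k)} → value v ≡ word j → K v ⊎ ∃[ d ] j ≡ s ↑ʳ d
  side j eq with splitAt s j in split
  ... | inj₁ c = inj₁ (c , trans eq (cong word (sym (Fin.splitAt⁻¹-↑ˡ split))))
  ... | inj₂ d = inj₂ (d , sym (Fin.splitAt⁻¹-↑ʳ split))

  -- The `k + r` neighbours outside `K` of a vertex of `K`: `k` by swaps, and `r` in the rest of the
  -- clique.
  neighbour : Fin s → Fin k ⊎ Fin r → Vec (Fin n) (suc k)
  neighbour c (inj₁ i) = swapFirst i (word (c ↑ˡ r))
  neighbour c (inj₂ d) = word (s ↑ʳ d)

  crossing-shape : ∀ {u v} → Crossing (u , v) →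
    ∃[ c ] ∃[ d ] value u ≡ word (c ↑ˡ r) × value v ≡ neighbour c d
  crossing-shape {u , _} {v , _} ((c , refl) , ¬Kv , swap i eq) = c , inj₁ i , refl , eq
  crossing-shape {u , _} {v , v!} ((c , refl) , ¬Kv , replace α α∉ refl)
    with j , refl ← symbol α (α∉ ∘ VecAny.there)
    with side j {v , v!} refl
  ... | inj₁ Kv         = contradiction Kv ¬Kv
  ... | inj₂ (d , refl) = c , inj₂ d , refl , refl

  -- The pair `(c , d)` of `crossing-shape` determines the edge. Equality follows later, from the
  -- lower bound for cuts.
  size≤ : EdgeSet.size boundary ≤ s * (k + r)
  size≤ = subst (EdgeSet.size boundary ≤_) (List.length-tabulate {n = s * (k + r)} (λ i → i))
    (pigeonhole Q clash unique-crossings (All.map (λ {e} → cover {e}) crossing))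
    where
    Q : P n (suc k) × P n (suc k) → Fin (s * (k + r)) → Set
    Q (u , v) z = ∃[ c ] ∃[ d ] z ≡ combine c (join k r d) × value u ≡ word (c ↑ˡ r) × value v ≡ neighbour c d

    clash : ∀ {e f z} → Q e z → Q f z → ¬ e ≢ f
    clash (c , d , z≡ , u≡ , v≡) (c′ , d′ , z≡′ , u≡′ , v≡′) e≢f
      with refl , eq ← Fin.combine-injective c (join k r d) c′ (join k r d′) (trans (sym z≡) z≡′)
      with refl ← trans (sym (Fin.splitAt-join k r d)) (trans (cong (splitAt k) eq) (Fin.splitAt-join k r d′)) =
      e≢f (cong₂ _,_ (value-injective (trans u≡ (sym u≡′))) (value-injective (trans v≡ (sym v≡′))))

    cover : ∀ {e} → Crossing e → Any (Q e) (allFin (s * (k + r)))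
    cover {e} Ce with c , d , u≡ , v≡ ← crossing-shape {proj₁ e} {proj₂ e} Ce =
      Any.map (λ { refl → c , d , refl , u≡ , v≡ }) (∈-allFin (combine c (join k r d)))

  G′ = G - boundary

  neighbours : P n (suc k) → List (P n (suc k))
  neighbours v = filter (Graph._~?_ G′ v) (Graph.vertices G)

  ∈-neighbours : ∀ {v w} → Graph._~_ G′ v w → w ∈ neighbours v
  ∈-neighbours {v} {w} v~w = ∈-filter⁺ (Graph._~?_ G′ v) (Graph.complete G w) v~w

  degree-inside : ∀ v → K v → s ≤ suc (degree G′ v)
  degree-inside v (c , v≡) = subst (_≤ suc (degree G′ v)) (List.length-tabulate {n = s} (λ i → i))
    (pigeonhole {A = Fin s} {B = P n (suc k)} (λ c w → value w ≡ word (c ↑ˡ r))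
      (λ w≡ w≡′ c≢c′ → c≢c′ (Fin.↑ˡ-injective r _ _ (word-injective (trans (sym w≡) w≡′))))
      (allFin⁺ s) (All.tabulate λ {c′} _ → cover c′))
    where
    cover : ∀ c′ → Any (λ w → value w ≡ word (c′ ↑ˡ r)) (v ∷ neighbours v)
    cover c′ with c Fin.≟ c′
    ... | yes refl = here v≡
    ... | no c≢c′  = there (Any.map (λ { refl → refl }) (∈-neighbours {v} {vertex (c′ ↑ˡ r)}
      (keep (subst (λ p → StarAdjacent p (word (c′ ↑ˡ r))) (sym v≡) (vertex-adjacent (c≢c′ ∘ Fin.↑ˡ-injective r _ _)))
        (λ _ → c′ , refl) (λ _ → c , v≡))))

  -- All `k` swaps change the tail, so they end outside the clique and survive the deletion.
  degree-clique : ∀ v → ¬ K v → Vec.tail (value v) ≡ tail → k ≤ degree G′ v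
  degree-clique v ¬Kv tail≡ = subst (_≤ degree G′ v) (List.length-tabulate {n = k} (λ i → i))
    (pigeonhole {A = Fin k} {B = P n (suc k)} (λ i w → value w ≡ swapFirst i (value v))
      (λ w≡ w≡′ i≢j → i≢j (swapFirst-injective (unique-value v) _ _ (trans (sym w≡) w≡′)))
      (allFin⁺ k) (All.tabulate λ {i} _ → Any.map (λ { refl → refl }) (∈-neighbours {v} {swapped i}
        (keep (swap i refl) (λ Kv → contradiction Kv ¬Kv) (λ (c , eq) →
          contradiction (trans eq (cong ((c ↑ˡ r ↑ˡ k) ∷_) (sym tail≡))) (swapFirst-tail (unique-value v) i {c ↑ˡ r ↑ˡ k}))))))
    where
    swapped : Fin k → P n (suc k)
    swapped i = swapFirst i (value v) , [ swapFirst-unique i (unique-value v) ]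

  -- Such a vertex keeps its whole clique: each of the `n` symbols is one of its `k + 1` entries or
  -- the head of a surviving neighbour obtained by replacement.
  degree-outside : ∀ v → Vec.tail (value v) ≢ tail → s + r ≤ suc (degree G′ v)
  degree-outside v@(x ∷ xs , [ v! ]) tail≢ = +-cancelˡ-≤ k _ _ (begin
    k + (s + r)
      ≡⟨ +-comm k (s + r) ⟩
    n
      ≡⟨ List.length-tabulate {n = n} (λ i → i) ⟨
    length (allFin n)
      ≤⟨ pigeonhole _≡_ (λ { refl refl i≢i → i≢i refl }) (allFin⁺ n) (All.tabulate λ {α} _ → cover α) ⟩
    length (Vec.toList (value v) ++ map (Vec.head ∘ value) (neighbours v))
      ≡⟨ List.length-++ (Vec.toList (value v)) ⟩
    length (Vec.toList (value v)) + length (map (Vec.head ∘ value) (neighbours v))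
      ≡⟨ cong₂ _+_ (Vec.length-toList (value v)) (List.length-map _ (neighbours v)) ⟩
    suc k + degree G′ v
      ≡⟨ +-suc k _ ⟨
    k + suc (degree G′ v) ∎)
    where
    open ≤-Reasoning
    outside : ∀ {α} → ¬ (∃[ c ] α ∷ xs ≡ word (c ↑ˡ r))
    outside (c , eq) = tail≢ (Vec.∷-injectiveʳ eq)
    cover : ∀ α → α ∈ (Vec.toList (value v) ++ map (Vec.head ∘ value) (neighbours v))
    cover α with DecMembership._∈?_ Fin._≟_ α (value v)
    ... | yes α∈ = Any.++⁺ˡ (∈-toList⁺ α∈)
    ... | no α∉  = Any.++⁺ʳ (Vec.toList (value v)) (∈-map⁺ (Vec.head ∘ value) {x = w} (∈-neighbours {v} {w}
      (keep (replace α α∉ refl) (λ Kv → contradiction Kv outside) (λ Kw → contradiction Kw outside))))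
      where
      w : P n (suc k)
      w = (α ∷ xs) , [ VecAll.lookup⁻ (λ i α≡ → α∉ (VecAny.there (subst (_∈ᵛ xs) (sym α≡) (∈-lookup i xs))))
                       VecAllPairs.∷ VecAllPairs.tail (unique-value v) ]

  -- The critical vertices are those of the clique outside `K`, which are only sure to keep their
  -- `k` swaps: there are none if `r` is 0, and otherwise `h ≤ k` suffices. By `1 ≤ k` some swap
  -- leaves `K` even if `K` is the whole clique.
  isEdgeCut : ∀ {h} → 1 ≤ k → h < s → r ≡ 0 ⊎ h ≤ k → IsEdgeCut h G boundary
  isEdgeCut {h} 1≤k h<s few = disconnected , minDegree
    where
    c₀ : Fin s
    c₀ = Fin.fromℕ< h<s
    i₀ : Fin k
    i₀ = Fin.fromℕ< 1≤k

    disconnected : Disconnected G′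
    disconnected = boundary-disconnects {vertex (c₀ ↑ˡ r)}
      {swapFirst i₀ (word (c₀ ↑ˡ r)) , [ swapFirst-unique i₀ (word! (c₀ ↑ˡ r)) ]}
      (c₀ , refl) (λ (c , eq) → swapFirst-tail (word! (c₀ ↑ˡ r)) i₀ eq)

    minDegree : MinDegreeAtLeast G′ h
    minDegree v@(x ∷ xs , [ v! ]) with K? v | Vec.≡-dec Fin._≟_ xs tail
    ... | yes Kv | _         = s≤s⁻¹ (≤-trans h<s (degree-inside v Kv))
    ... | no _   | no tail≢  = s≤s⁻¹ (≤-trans h<s (≤-trans (m≤m+n s r) (degree-outside v tail≢)))
    ... | no ¬Kv | yes refl  = ≤-trans (h≤k few) (degree-clique v ¬Kv refl)
      where
      h≤k : r ≡ 0 ⊎ h ≤ k → h ≤ k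
      h≤k (inj₂ h≤k) = h≤k
      h≤k (inj₁ r≡0) with j , refl ← symbol x (head∉tail (unique-value v)) with side j {v} refl
      ... | inj₁ Kv      = contradiction Kv ¬Kv
      ... | inj₂ (d , _) with () ← subst Fin r≡0 d

-- With n = s + r + k, the products are s (n - s) and x (n - x).
clique-cut-optimal : ∀ s r k {h} → 1 ≤ k → h < s → r ≡ 0 ⊎ h ≤ k →
  (∀ x r′ → suc h ≤ x → x + r′ ≡ s + r → s * (k + r) ≤ x * (r′ + k)) →
  SuperEdgeConnectivity h (S (s + r + k) (suc k)) (s * (k + r))
clique-cut-optimal s r k {h} 1≤k h<s few bound =
  (boundary , isCut , ≤-antisym size≤ (lower boundary isCut)) , lower
  where
  open CliqueCut s r k
  open Boundary G K? using (boundary)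
  isCut = isEdgeCut 1≤k h<s few
  lower : ∀ B → IsEdgeCut h G B → s * (k + r) ≤ EdgeSet.size B
  lower = cut-lower-bound refl (≤-trans h<s (m≤m+n s r)) bound

-- Minimising x (n - x) over the admissible sizes

small-clique-optimal : ∀ {h k r} → suc h ≤ k → ∀ x r′ → suc h ≤ x → x + r′ ≡ suc h + r →
                       suc h * (k + r) ≤ x * (r′ + k)
small-clique-optimal {h} {k} {r} h<k x r′ h<x eq with d , refl ← m≤n⇒∃[o]m+o≡n h<x
  with refl ← +-cancelˡ-≡ (suc h) (d + r′) r (trans (sym (+-assoc (suc h) d r′)) eq) = begin
  suc h * (k + (d + r′))            ≡⟨ expand (suc h) k d r′ ⟩
  suc h * (r′ + k) + d * suc h      ≤⟨ +-monoʳ-≤ (suc h * (r′ + k)) (*-monoʳ-≤ d (≤-trans h<k (m≤n+m k r′))) ⟩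
  suc h * (r′ + k) + d * (r′ + k)   ≡⟨ *-distribʳ-+ (r′ + k) (suc h) d ⟨
  (suc h + d) * (r′ + k)            ∎
  where
  open ≤-Reasoning
  expand : ∀ s k d r → s * (k + (d + r)) ≡ s * (r + k) + d * s
  expand = solve-∀

full-clique-optimal : ∀ {h k m} → k ≤ h → ∀ x r′ → suc h ≤ x → x + r′ ≡ m + 0 →
                      m * (k + 0) ≤ x * (r′ + k)
full-clique-optimal {h} {k} {m} k≤h x r′ h<x eq with refl ← trans (sym (+-identityʳ m)) (sym eq) = begin
  (x + r′) * (k + 0)     ≡⟨ expand x r′ k ⟩
  -- The difference of the products is `r′ * (x - k)`, and `k ≤ h < x`.
  k * r′ + x * k         ≤⟨ +-monoˡ-≤ (x * k) (*-monoˡ-≤ r′ (≤-trans k≤h (<⇒≤ h<x))) ⟩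
  x * r′ + x * k         ≡⟨ *-distribˡ-+ x r′ k ⟨
  x * (r′ + k)           ∎
  where
  open ≤-Reasoning
  expand : ∀ x r k → (x + r) * (k + 0) ≡ k * r + x * k
  expand = solve-∀

if-does : ∀ {P A : Set} (T : A → Set) (P? : Dec P) {a b : A} → (P → T a) → (¬ P → T b) →
          T (if does P? then a else b)
if-does T (yes p) Ta Tb = Ta p
if-does T (no ¬p) Ta Tb = Tb ¬p

theorem1p1 : ∀ (n k h : ℕ) → 2 ≤ k → k ≤ n ∸ 1 → h ≤ n ∸ k →
    SuperEdgeConnectivity h (S n k)
    (if does ((h ≤? k ∸ 2) ×-dec (2 * (h + 1) ≤? n))
    then (n ∸ h ∸ 1) * (h + 1)
    else (n ∸ k + 1) * (k ∸ 1))
theorem1p1 n (suc (suc j)) h 2≤k k≤n-1 h≤m′ =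
  if-does (SuperEdgeConnectivity h (S n (suc k))) ((h ≤? j) ×-dec (2 * (h + 1) ≤? n)) small full
  where
  -- From here on `k` is the length of the tail, one less than in the statement, and the clique size
  -- is `suc m′`.
  k  = suc j
  m′ = n ∸ suc k

  k<n : suc k ≤ n
  k<n = ≤-trans k≤n-1 (m∸n≤m n 1)

  n≡ : suc m′ + k ≡ n
  n≡ = trans (sym (+-suc m′ k)) (m∸n+n≡m k<n)

  small : h ≤ j × 2 * (h + 1) ≤ n → SuperEdgeConnectivity h (S n (suc k)) ((n ∸ h ∸ 1) * (h + 1))
  small (h≤j , _) = subst₂ (λ n b → SuperEdgeConnectivity h (S n (suc k)) b) n≡′ b≡
    (clique-cut-optimal (suc h) r k (s≤s z≤n) ≤-refl (inj₂ (m≤n⇒m≤1+n h≤j)) (small-clique-optimal (s≤s h≤j)))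
    where
    r = m′ ∸ h
    n≡′ : suc h + r + k ≡ n
    n≡′ = trans (cong (λ m → suc (m + k)) (m+[n∸m]≡n h≤m′)) n≡
    b≡ : suc h * (k + r) ≡ (n ∸ h ∸ 1) * (h + 1)
    b≡ = trans (*-comm (suc h) (k + r)) (cong₂ _*_ (sym n-h-1) (+-comm 1 h))
      where
      open ≡-Reasoning
      n-h-1 : n ∸ h ∸ 1 ≡ k + r
      n-h-1 = begin
        n ∸ h ∸ 1                    ≡⟨ ∸-+-assoc n h 1 ⟩
        n ∸ (h + 1)                  ≡⟨ cong₂ _∸_ (sym n≡′) (+-comm h 1) ⟩
        suc h + r + k ∸ suc h        ≡⟨ cong (_∸ suc h) (+-assoc (suc h) r k) ⟩
        suc h + (r + k) ∸ suc h      ≡⟨ m+n∸m≡n (suc h) (r + k) ⟩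
        r + k                        ≡⟨ +-comm r k ⟩
        k + r                        ∎

  full : ¬ (h ≤ j × 2 * (h + 1) ≤ n) → SuperEdgeConnectivity h (S n (suc k)) ((n ∸ suc k + 1) * k)
  full ¬small = subst₂ (λ n b → SuperEdgeConnectivity h (S n (suc k)) b)
    (trans (cong (_+ k) (+-identityʳ (suc m′))) n≡)
    (cong₂ _*_ (+-comm 1 m′) (+-identityʳ k))
    (clique-cut-optimal (suc m′) 0 k (s≤s z≤n) (s≤s h≤m′) (inj₁ refl)
      (full-clique-optimal (≰⇒> λ h≤j → ¬small (h≤j , half h≤j))))
    where
    -- `n` is the sum of the clique size and the tail length, both at least `h + 1`. Thus the
    -- negated condition yields `k ≤ h`.
    half : h ≤ j → 2 * (h + 1) ≤ n
    half h≤j = subst₂ _≤_ (double h) n≡ (+-mono-≤ (s≤s h≤m′) (s≤s h≤j))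
      where
      double : ∀ h → suc h + suc h ≡ 2 * (h + 1)
      double = solve-∀
theorem1p1 n (suc zero) h (s≤s ()) _ _
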